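{- Let $G=G([n],E)$ be a simple graph and let $$P_G:=\Big\{x\in\mathbb{R}^{[n]}:\ \sum_{i\in[n]}x_i=n+|E|\ \text{ and }\ \sum_{i\in\sigma}x_i\ \ge\ |\sigma|+|E(G[\sigma])|\ \text{ for all }\sigma\subseteq[n]\Big\}.$$ Then the face complex of the polytope $P_G$ is a polytopal complex realization of the abstract cell complex $\mathscr{Z}_G$: there is a bijection between the nonempty faces of $P_G$ and the partial acyclic orientations of $G$ such that, if the faces $F,F'$ correspond to $O,O'$, then $F\subseteq F'$ if and only if $O\preceq_z O'$, and the affine dimension of $F$ equals $\dim_G(O)$.
   Context: Let $G=G(V,E)$ be a finite simple graph, and write $G[\sigma]$ for the subgraph induced on $\sigma\subseteq V$. An orientation of $G$ is a function $O$ assigning to each edge $e=\{u,v\}$ one of $e$ (the edge is left undirected), $(u,v)$, or $(v,u)$. A partition $\Sigma$ of $V$ is a connected partition of $G$ if $G[\sigma]$ is connected for every block $\sigma\in\Sigma$. The partition graph $G^\Sigma$ has vertex set $\Sigma$, and two distinct blocks $\sigma,\rho$ are adjacent iff some edge of $G$ joins a vertex of $\sigma$ to a vertex of $\rho$. An acyclic orientation of a graph orients every edge and has no directed cycle; it induces a partial order on the vertices (transitive closure, where $(a,b)$ means $a<b$). An orientation $O$ of $G$ is a partial acyclic orientation (p.a.o.) of $G$ if there exist a connected partition $\Sigma$ of $G$ and an acyclic orientation $O^\Sigma$ of $G^\Sigma$ such that every edge contained in a block of $\Sigma$ is left undirected by $O$, and every edge $\{u,v\}$ with $u\in\sigma$,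 $v\in\rho$, $\sigma\neq\rho$, satisfies $O(\{u,v\})=(u,v)$ whenever $O^\Sigma(\{\sigma,\rho\})=(\sigma,\rho)$. For such $O$ put $\dim_G(O)=|V|-|\Sigma|$, and let $J_G(O)$ be the collection of all subsets $\bigcup_{\sigma\in I}\sigma\subseteq V$, where $I$ ranges over the order ideals (down-closed subsets, including $\emptyset$) of the poset on $\Sigma$ induced by $O^\Sigma$. The abstract cell complex $\mathscr{Z}_G$ has as cells the p.a.o.'s of $G$, with order $O_1\preceq_z O_2$ iff $J_G(O_2)\subseteq J_G(O_1)$, and dimension function $\dim_G$.
   Formalization: The polytope P_G is taken as a set of rational points, and its faces (cut out by valid linear inequalities with rational coefficients) and affine dimensions are taken over the rationals instead of the reals. -}

module Defs where

open import Level using (0ℓ)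
open import Data.Bool using (Bool; true; false; if_then_else_; _∧_)
open import Data.Nat as ℕ using (ℕ; zero; suc; _∸_)
open import Data.Fin using (Fin; zero; suc; _<_)
open import Data.Fin.Properties using (any?; _≟_; _<?_)
open import Data.Fin.Subset using (Subset; _∈_; ⊤; ∣_∣)
open import Data.Vec using (lookup)
open import Data.Integer using (+_)
open import Data.Rational using (ℚ; _+_; _*_; _-_; _≤_; 0ℚ; _/_)
open import Data.Product using (Σ; ∃; _×_; _,_)
open import Data.Empty using (⊥)
open import Data.Sum using (_⊎_)
open import Relation.Nullary using (¬_; does)
open import Relation.Binary.PropositionalEquality using (_≡_; _≢_)
open import Relation.Binary.Construct.Closure.Transitive using (TransClosure)
open import Relation.Binary.Construct.Closure.ReflexiveTransitive using (Star)
open import Function.Bundles using (_⇔_)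

sumℕ : ∀ n → (Fin n → ℕ) → ℕ
sumℕ zero    f = 0
sumℕ (suc n) f = f zero ℕ.+ sumℕ n (λ i → f (suc i))

sumℚ : ∀ n → (Fin n → ℚ) → ℚ
sumℚ zero    f = 0ℚ
sumℚ (suc n) f = f zero + sumℚ n (λ i → f (suc i))

ℕ→ℚ : ℕ → ℚ
ℕ→ℚ k = + k / 1

record Graph (n : ℕ) : Set where
  field
    adj    : Fin n → Fin n → Bool
    sym    : ∀ i j → adj i j ≡ adj j i
    irrefl : ∀ i → adj i i ≡ false
open Graph public

Adj : ∀ {n} → Graph n → Fin n → Fin n → Set
Adj G u v = adj G u v ≡ true

edgesIn : ∀ {n} → Graph n → Subset n → ℕ
edgesIn {n} G σ = sumℕ n λ i → sumℕ n λ j →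
  if does (i <? j) ∧ adj G i j ∧ lookup σ i ∧ lookup σ j then 1 else 0

numEdges : ∀ {n} → Graph n → ℕ
numEdges G = edgesIn G ⊤

Point : ℕ → Set
Point n = Fin n → ℚ

sumOver : ∀ {n} → Subset n → Point n → ℚ
sumOver {n} σ x = sumℚ n λ i → if lookup σ i then x i else 0ℚ

PG : ∀ {n} → Graph n → Point n → Set
PG {n} G x =
  (sumℚ n x ≡ ℕ→ℚ (n ℕ.+ numEdges G)) ×
  (∀ (σ : Subset n) → ℕ→ℚ (∣ σ ∣ ℕ.+ edgesIn G σ) ≤ sumOver σ x)

dot : ∀ {n} → Point n → Point n → ℚ
dot {n} c x = sumℚ n λ i → c i * x i

IsFace : ∀ {n} → (Point n → Set) → (Point n → Set) → Set
IsFace {n} P F = Σ (Point n) λ c → Σ ℚ λ δ →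
  (∀ x → P x → dot c x ≤ δ) × (∀ x → F x ⇔ (P x × dot c x ≡ δ))

Nonempty : ∀ {n} → (Point n → Set) → Set
Nonempty {n} F = Σ (Point n) F

_⊆ₚ_ : ∀ {n} → (Point n → Set) → (Point n → Set) → Set
_⊆ₚ_ {n} F F' = ∀ (x : Point n) → F x → F' x

_≐_ : ∀ {n} → (Point n → Set) → (Point n → Set) → Set
F ≐ F' = (F ⊆ₚ F') × (F' ⊆ₚ F)

AffIndep : ∀ {n k} → (Fin (suc k) → Point n) → Set
AffIndep {n} {k} p = ∀ (λs : Fin k → ℚ) →
  (∀ (t : Fin n) → sumℚ k (λ i → λs i * (p (suc i) t - p zero t)) ≡ 0ℚ) →
  ∀ i → λs i ≡ 0ℚ

AffDim : ∀ {n} → (Point n → Set) → ℕ → Set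
AffDim {n} F d =
  (Σ (Fin (suc d) → Point n) λ p → (∀ i → F (p i)) × AffIndep p) ×
  (∀ (p : Fin (suc (suc d)) → Point n) → (∀ i → F (p i)) → ¬ AffIndep p)

-- Orientations.  An orientation is read on pairs i < j only:
-- O i j = und : edge {i,j} undirected; fwd : (i,j); bwd : (j,i).

data Mark : Set where
  und fwd bwd : Mark

Orientation : ℕ → Set
Orientation n = Fin n → Fin n → Mark

Undir : ∀ {n} → Orientation n → Fin n → Fin n → Set
Undir O u v = (u < v → O u v ≡ und) × (v < u → O v u ≡ und)

Arrow : ∀ {n} → Orientation n → Fin n → Fin n → Set
Arrow O u v = (u < v → O u v ≡ fwd) × (v < u → O v u ≡ bwd)

_≈ₒ⟨_⟩_ : ∀ {n} → Orientation n → Graph n → Orientation n → Set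
O ≈ₒ⟨ G ⟩ O' = ∀ i j → i < j → Adj G i j → O i j ≡ O' i j

-- Connected partitions, encoded by a block-labelling β : [n] → [n]
-- (u and v lie in the same block iff β u ≡ β v).

SameBlockStep : ∀ {n} → Graph n → (Fin n → Fin n) → Fin n → Fin n → Set
SameBlockStep G β u v = Adj G u v × (β u ≡ β v)

ConnectedPartition : ∀ {n} → Graph n → (Fin n → Fin n) → Set
ConnectedPartition G β = ∀ u v → β u ≡ β v → Star (SameBlockStep G β) u v

numBlocks : ∀ {n} → (Fin n → Fin n) → ℕ
numBlocks {n} β = sumℕ n λ a → if does (any? (λ u → β u ≟ a)) then 1 else 0

BlockAdj : ∀ {n} → Graph n → (Fin n → Fin n) → Fin n → Fin n → Set
BlockAdj G β a b = (a ≢ b) × ∃ λ u → ∃ λ v → (β u ≡ a) × (β v ≡ b) × Adj G u v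

-- an orientation ω of G^Σ: ω a b ≡ true means the edge is oriented (a,b)
DirEdge : ∀ {n} → Graph n → (Fin n → Fin n) → (Fin n → Fin n → Bool) → Fin n → Fin n → Set
DirEdge G β ω a b = BlockAdj G β a b × (ω a b ≡ true)

IsAcyclicOrientation : ∀ {n} → Graph n → (Fin n → Fin n) → (Fin n → Fin n → Bool) → Set
IsAcyclicOrientation G β ω =
  (∀ a b → BlockAdj G β a b → (ω a b ≡ true) ⊎ (ω b a ≡ true)) ×
  (∀ a b → BlockAdj G β a b → ω a b ≡ true → ω b a ≡ false) ×
  (∀ a → ¬ TransClosure (DirEdge G β ω) a a)

-- Partial acyclic orientations, packaged with a witnessing
-- connected partition Σ (via β) and acyclic orientation O^Σ (via ω).

record PAO {n : ℕ} (G : Graph n) : Set where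
  field
    ori      : Orientation n
    β        : Fin n → Fin n
    ω        : Fin n → Fin n → Bool
    conn     : ConnectedPartition G β
    acyc     : IsAcyclicOrientation G β ω
    inside   : ∀ u v → Adj G u v → β u ≡ β v → Undir ori u v
    between  : ∀ u v → Adj G u v → β u ≢ β v → ω (β u) (β v) ≡ true → Arrow ori u v
open PAO public

dimG : ∀ {n} {G : Graph n} → PAO G → ℕ
dimG {n} O = n ∸ numBlocks (β O)

IsIdeal : ∀ {n} {G : Graph n} → PAO G → Subset n → Set
IsIdeal {G = G} O I = ∀ a b → TransClosure (DirEdge G (β O) (ω O)) a b → b ∈ I → a ∈ I

InJ : ∀ {n} {G : Graph n} → PAO G → Subset n → Set
InJ {n} O S = Σ (Subset n) λ I → IsIdeal O I × (∀ (v : Fin n) → (v ∈ S) ⇔ (β O v ∈ I))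

_⪯z_ : ∀ {n} {G : Graph n} → PAO G → PAO G → Set
_⪯z_ {n} O₁ O₂ = ∀ (S : Subset n) → InJ O₂ S → InJ O₁ S

{-# OPTIONS --safe #-}
module Submission where

-- An orientation O makes a set S closed if S contains u whenever it contains v
-- and uv is an edge that is undirected or oriented (u,v); the closed sets of a
-- p.a.o. are exactly the members of J_G(O).  Write f(S) = |S| + |E(G[S])|; the
-- face of O consists of the points of P_G with x(S) = f(S) for all closed S.
--
-- Splitting every edge between its endpoints (evenly if undirected, otherwise
-- giving all of it to the head) yields a point, the center of O, whose tight
-- sets are exactly the closed sets and which has slack at least 1/2 on every
-- other set.  Hence inclusion of faces is reverse inclusion of the J_G(O), and
-- moving 1/2 from a vertex to another one of its block stays in the face, which
-- gives |V| - |Σ| independent directions.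
--
-- The support function of P_G is c ↦ Σ c_v + Σ_{uv ∈ E} max(c_u, c_v), by Abel
-- summation over the sublevel sets of c.  If c is ordered along every edge as O
-- prescribes, the face of O is the set of maximisers of c.  Every p.a.o. has such
-- a c (the size of the generated ideal), and every c comes from the p.a.o. whose
-- blocks are the components of the level sets of c.

open import Defs
open import Algebra.Bundles using (CommutativeMonoid)
import Algebra.Properties.CommutativeMonoid.Sum as MonoidSum
import Data.Bool as Bool
open import Data.Bool using (Bool; true; false; if_then_else_; not; _∧_)
open import Data.Bool.Properties using (∧-zeroʳ; ∧-comm)
open import Data.Empty using (⊥-elim)
open import Data.Fin as Fin using (Fin; zero; suc; punchIn)
import Data.Fin.Properties as Fin
open import Data.Fin.Properties using (any?; _<?_; punchInᵢ≢i; suc-injective)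
open import Data.Fin.Subset using (Subset; _∈_; _∉_; _⊂_; _⊃_; _⊆_; _∪_; ⁅_⁆; ⊤; ∣_∣)
open import Data.Fin.Subset.Induction using (⊂-wellFounded; ⊃-wellFounded; Acc; acc)
open import Data.Fin.Subset.Properties using (_∈?_; nonempty?; ⊆-antisym; x∈⁅x⁆; x∈⁅y⁆⇒x≡y; x∈p∪q⁺; x∈p∪q⁻; ∣⊤∣≡n; ∈⊤; p⊆q⇒∣p∣≤∣q∣; p⊂q⇒∣p∣<∣q∣)
import Data.Integer as ℤ
import Data.Integer.Properties as ℤ
open import Data.Nat as ℕ using (ℕ; zero; suc; _∸_)
import Data.Nat.Properties as ℕ
open import Data.Product using (Σ; ∃; _×_; _,_; proj₁; proj₂)
open import Data.Rational as ℚ using (ℚ; 0ℚ; 1ℚ; ½; _+_; _*_; _-_; _≤_; _<_; -_; _⊔_; _⊓_)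
import Data.Rational.Properties as ℚ
open import Data.Rational.Solver using (module +-*-Solver)
import Data.Rational.Unnormalised as ℚᵘ
import Data.Rational.Unnormalised.Properties as ℚᵘ
open import Data.Sum using (_⊎_; inj₁; inj₂; [_,_]′)
open import Data.Unit using (tt) renaming (⊤ to Unit)
open import Data.Vec using (tabulate; lookup; []; _∷_)
open import Data.Vec.Functional using (insertAt)
open import Data.Vec.Functional.Properties using (insertAt-lookup; insertAt-punchIn)
open import Data.Vec.Properties using (lookup∘tabulate; []=⇒lookup; lookup⇒[]=; lookup-replicate)
open import Function using (_∘_)
open import Function.Bundles using (_⇔_; mk⇔; module Equivalence)
open import Relation.Binary.Construct.Closure.ReflexiveTransitive as Star using (Star; ε; _◅_; _◅◅_)
open import Relation.Binary.Construct.Closure.Transitive using (TransClosure; [_]; _∷_; _++_)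
open import Relation.Binary.Definitions using (Tri; tri<; tri≈; tri>)
open import Relation.Binary.PropositionalEquality using (_≡_; _≢_; refl; trans; cong; cong₂; subst; subst₂; module ≡-Reasoning) renaming (sym to ≡-sym)
open import Relation.Nullary using (¬_; Dec; yes; no; does)
open import Relation.Nullary.Decidable using (_×-dec_; ¬?; dec-true; dec-false; decidable-stable; toWitness)

open +-*-Solver using (solve; _:+_; _:*_; _:-_; :-_; _:=_; con)

-- Finite sums

sum-single : ∀ {c ℓ} (M : CommutativeMonoid c ℓ) → let open CommutativeMonoid M renaming (ε to 0#); open MonoidSum M in
  ∀ {n} (f : Fin n → Carrier) i → (∀ j → j ≢ i → f j ≈ 0#) → sum f ≈ f i
sum-single M {suc n} f i f≈0 = begin
  sum f                            ≈⟨ sum-remove f ⟩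
  f i ∙ sum (f ∘ punchIn i)        ≈⟨ ∙-congˡ (sum-cong-≋ λ j → f≈0 _ (punchInᵢ≢i i j)) ⟩
  f i ∙ sum {n} (λ _ → 0#)         ≈⟨ ∙-congˡ (sum-replicate-zero n) ⟩
  f i ∙ 0#                         ≈⟨ identityʳ _ ⟩
  f i                              ∎
  where
  open CommutativeMonoid M renaming (ε to 0#)
  open MonoidSum M
  open import Relation.Binary.Reasoning.Setoid setoid

module Sumℚ = MonoidSum ℚ.+-0-commutativeMonoid
module Sumℕ = MonoidSum ℕ.+-0-commutativeMonoid

sumℚ≡sum : ∀ n f → sumℚ n f ≡ Sumℚ.sum f
sumℚ≡sum zero    f = refl
sumℚ≡sum (suc n) f = cong (f zero +_) (sumℚ≡sum n (f ∘ suc))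

sumℕ≡sum : ∀ n f → sumℕ n f ≡ Sumℕ.sum f
sumℕ≡sum zero    f = refl
sumℕ≡sum (suc n) f = cong (f zero ℕ.+_) (sumℕ≡sum n (f ∘ suc))

sumℚ-cong : ∀ n {f g} → (∀ i → f i ≡ g i) → sumℚ n f ≡ sumℚ n g
sumℚ-cong zero    f≡g = refl
sumℚ-cong (suc n) f≡g = cong₂ _+_ (f≡g zero) (sumℚ-cong n (f≡g ∘ suc))

sumℕ-cong : ∀ n {f g} → (∀ i → f i ≡ g i) → sumℕ n f ≡ sumℕ n g
sumℕ-cong zero    f≡g = refl
sumℕ-cong (suc n) f≡g = cong₂ ℕ._+_ (f≡g zero) (sumℕ-cong n (f≡g ∘ suc))

sumℚ-single : ∀ n f i → (∀ j → j ≢ i → f j ≡ 0ℚ) → sumℚ n f ≡ f i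
sumℚ-single n f i f≡0 = trans (sumℚ≡sum n f) (sum-single ℚ.+-0-commutativeMonoid f i f≡0)

sumℕ-single : ∀ n f i → (∀ j → j ≢ i → f j ≡ 0) → sumℕ n f ≡ f i
sumℕ-single n f i f≡0 = trans (sumℕ≡sum n f) (sum-single ℕ.+-0-commutativeMonoid f i f≡0)

sumℚ-remove : ∀ n f i → sumℚ (suc n) f ≡ f i + sumℚ n (f ∘ punchIn i)
sumℚ-remove n f i = trans (sumℚ≡sum _ f) (trans (Sumℚ.sum-remove f)
  (cong (f i +_) (≡-sym (sumℚ≡sum n _))))

sumℚ-swap : ∀ m n (f : Fin m → Fin n → ℚ) →
  sumℚ m (λ i → sumℚ n (f i)) ≡ sumℚ n (λ j → sumℚ m (λ i → f i j))
sumℚ-swap m n f = begin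
  sumℚ m (λ i → sumℚ n (f i))                ≡⟨ sumℚ-cong m (λ i → sumℚ≡sum n (f i)) ⟩
  sumℚ m (λ i → Sumℚ.sum (f i))              ≡⟨ sumℚ≡sum m _ ⟩
  Sumℚ.sum (λ i → Sumℚ.sum (f i))            ≡⟨ Sumℚ.∑-comm f ⟩
  Sumℚ.sum (λ j → Sumℚ.sum (λ i → f i j))    ≡⟨ sumℚ≡sum n _ ⟨
  sumℚ n (λ j → Sumℚ.sum (λ i → f i j))      ≡⟨ sumℚ-cong n (λ j → ≡-sym (sumℚ≡sum m _)) ⟩
  sumℚ n (λ j → sumℚ m (λ i → f i j))        ∎
  where open ≡-Reasoning

sumℕ-swap : ∀ m n (f : Fin m → Fin n → ℕ) →
  sumℕ m (λ i → sumℕ n (f i)) ≡ sumℕ n (λ j → sumℕ m (λ i → f i j))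
sumℕ-swap m n f = begin
  sumℕ m (λ i → sumℕ n (f i))                ≡⟨ sumℕ-cong m (λ i → sumℕ≡sum n (f i)) ⟩
  sumℕ m (λ i → Sumℕ.sum (f i))              ≡⟨ sumℕ≡sum m _ ⟩
  Sumℕ.sum (λ i → Sumℕ.sum (f i))            ≡⟨ Sumℕ.∑-comm f ⟩
  Sumℕ.sum (λ j → Sumℕ.sum (λ i → f i j))    ≡⟨ sumℕ≡sum n _ ⟨
  sumℕ n (λ j → Sumℕ.sum (λ i → f i j))      ≡⟨ sumℕ-cong n (λ j → ≡-sym (sumℕ≡sum m _)) ⟩
  sumℕ n (λ j → sumℕ m (λ i → f i j))        ∎
  where open ≡-Reasoning

sumℚ-linear : ∀ n a t b → sumℚ n (λ i → a i + t * b i) ≡ sumℚ n a + t * sumℚ n b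
sumℚ-linear zero    a t b = ≡-sym (trans (ℚ.+-identityˡ _) (ℚ.*-zeroʳ t))
sumℚ-linear (suc n) a t b = trans (cong (a zero + t * b zero +_) (sumℚ-linear n (a ∘ suc) t (b ∘ suc)))
  (solve 5 (λ a₀ t b₀ A B →
      (a₀ :+ t :* b₀) :+ (A :+ t :* B) := (a₀ :+ A) :+ t :* (b₀ :+ B)) refl
    (a zero) t (b zero) (sumℚ n (a ∘ suc)) (sumℚ n (b ∘ suc)))

sumℚ-mono : ∀ n {f g} → (∀ i → f i ≤ g i) → sumℚ n f ≤ sumℚ n g
sumℚ-mono zero    f≤g = ℚ.≤-refl
sumℚ-mono (suc n) f≤g = ℚ.+-mono-≤ (f≤g zero) (sumℚ-mono n (f≤g ∘ suc))

sumℚ-zero : ∀ n → sumℚ n (λ _ → 0ℚ) ≡ 0ℚ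
sumℚ-zero n = trans (sumℚ≡sum n _) (Sumℚ.sum-replicate-zero n)

sumℚ-+ : ∀ n a b → sumℚ n (λ i → a i + b i) ≡ sumℚ n a + sumℚ n b
sumℚ-+ n a b = begin
  sumℚ n (λ i → a i + b i)      ≡⟨ sumℚ-cong n (λ i → cong (a i +_) (≡-sym (ℚ.*-identityˡ (b i)))) ⟩
  sumℚ n (λ i → a i + 1ℚ * b i) ≡⟨ sumℚ-linear n a 1ℚ b ⟩
  sumℚ n a + 1ℚ * sumℚ n b      ≡⟨ cong (sumℚ n a +_) (ℚ.*-identityˡ (sumℚ n b)) ⟩
  sumℚ n a + sumℚ n b           ∎
  where open ≡-Reasoning

sumℚ-*ˡ : ∀ n t b → sumℚ n (λ i → t * b i) ≡ t * sumℚ n b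
sumℚ-*ˡ n t b = begin
  sumℚ n (λ i → t * b i)               ≡⟨ sumℚ-cong n (λ i → ≡-sym (ℚ.+-identityˡ _)) ⟩
  sumℚ n (λ i → 0ℚ + t * b i)          ≡⟨ sumℚ-linear n (λ _ → 0ℚ) t b ⟩
  sumℚ n (λ _ → 0ℚ) + t * sumℚ n b     ≡⟨ cong (_+ t * sumℚ n b) (sumℚ-zero n) ⟩
  0ℚ + t * sumℚ n b                    ≡⟨ ℚ.+-identityˡ _ ⟩
  t * sumℚ n b                         ∎
  where open ≡-Reasoning

single≤sumℚ : ∀ n f i → (∀ j → 0ℚ ≤ f j) → f i ≤ sumℚ n f
single≤sumℚ (suc n) f i 0≤f = begin
  f i                              ≡⟨ ℚ.+-identityʳ _ ⟨
  f i + 0ℚ                         ≡⟨ cong (f i +_) (sumℚ-zero n) ⟨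
  f i + sumℚ n (λ _ → 0ℚ)          ≤⟨ ℚ.+-monoʳ-≤ (f i) (sumℚ-mono n (λ j → 0≤f _)) ⟩
  f i + sumℚ n (f ∘ punchIn i)     ≡⟨ sumℚ-remove n f i ⟨
  sumℚ (suc n) f                   ∎
  where open ℚ.≤-Reasoning

-- `ℕ→ℚ` normalises its fraction, so its algebra and order are checked on unnormalised rationals.
toℚᵘ-ℕ→ℚ : ∀ k → ℚ.toℚᵘ (ℕ→ℚ k) ℚᵘ.≃ ℚᵘ.mkℚᵘ (ℤ.+ k) 0
toℚᵘ-ℕ→ℚ k = ℚ.toℚᵘ-fromℚᵘ (ℚᵘ.mkℚᵘ (ℤ.+ k) 0)

ℕ→ℚ-+ : ∀ a b → ℕ→ℚ (a ℕ.+ b) ≡ ℕ→ℚ a + ℕ→ℚ b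
ℕ→ℚ-+ a b = ℚ.toℚᵘ-injective (begin
  ℚ.toℚᵘ (ℕ→ℚ (a ℕ.+ b))                        ≈⟨ toℚᵘ-ℕ→ℚ (a ℕ.+ b) ⟩
  ℚᵘ.mkℚᵘ (ℤ.+ (a ℕ.+ b)) 0                     ≈⟨ ℚᵘ.*≡* (cong (ℤ._* ℤ.+ 1) (cong₂ ℤ._+_
                                                     (≡-sym (ℤ.*-identityʳ (ℤ.+ a))) (≡-sym (ℤ.*-identityʳ (ℤ.+ b))))) ⟩
  ℚᵘ.mkℚᵘ (ℤ.+ a) 0 ℚᵘ.+ ℚᵘ.mkℚᵘ (ℤ.+ b) 0      ≈⟨ ℚᵘ.+-cong (toℚᵘ-ℕ→ℚ a) (toℚᵘ-ℕ→ℚ b) ⟨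
  ℚ.toℚᵘ (ℕ→ℚ a) ℚᵘ.+ ℚ.toℚᵘ (ℕ→ℚ b)            ≈⟨ ℚ.toℚᵘ-homo-+ (ℕ→ℚ a) (ℕ→ℚ b) ⟨
  ℚ.toℚᵘ (ℕ→ℚ a + ℕ→ℚ b)                        ∎)
  where open import Relation.Binary.Reasoning.Setoid ℚᵘ.≃-setoid

ℕ→ℚ-sum : ∀ n f → ℕ→ℚ (sumℕ n f) ≡ sumℚ n (ℕ→ℚ ∘ f)
ℕ→ℚ-sum zero    f = refl
ℕ→ℚ-sum (suc n) f = trans (ℕ→ℚ-+ (f zero) (sumℕ n (f ∘ suc)))
  (cong (ℕ→ℚ (f zero) +_) (ℕ→ℚ-sum n (f ∘ suc)))

ℕ→ℚ-mono-≤ : ∀ {a b} → a ℕ.≤ b → ℕ→ℚ a ≤ ℕ→ℚ b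
ℕ→ℚ-mono-≤ {a} {b} a≤b = ℚ.toℚᵘ-cancel-≤ (ℚᵘ.≤-respˡ-≃ (ℚᵘ.≃-sym (toℚᵘ-ℕ→ℚ a))
  (ℚᵘ.≤-respʳ-≃ (ℚᵘ.≃-sym (toℚᵘ-ℕ→ℚ b)) (ℚᵘ.*≤* (ℤ.*-monoʳ-≤-nonNeg (ℤ.+ 1) (ℤ.+≤+ a≤b)))))

ℕ→ℚ-cancel-≤ : ∀ {a b} → ℕ→ℚ a ≤ ℕ→ℚ b → a ℕ.≤ b
ℕ→ℚ-cancel-≤ {a} {b} p with ℚᵘ.≤-respˡ-≃ (toℚᵘ-ℕ→ℚ a)
  (ℚᵘ.≤-respʳ-≃ (toℚᵘ-ℕ→ℚ b) (ℚ.toℚᵘ-mono-≤ p))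
... | ℚᵘ.*≤* q = ℤ.drop‿+≤+ (ℤ.*-cancelʳ-≤-pos (ℤ.+ a) (ℤ.+ b) (ℤ.+ 1) q)

-- Linear dependence

count : ∀ n → (Fin n → Bool) → ℕ
count n N = sumℕ n λ t → if N t then 1 else 0

enumerate : ∀ n N → Σ (Fin (count n N) → Fin n) λ e →
  (∀ i → N (e i) ≡ true) × (∀ i j → e i ≡ e j → i ≡ j)
enumerate zero    N = (λ ()) , (λ ()) , (λ ())
enumerate (suc n) N with N zero in N₀ | enumerate n (N ∘ suc)
... | false | e , true-e , inj-e = suc ∘ e , true-e , λ i j eq → inj-e i j (suc-injective eq)
... | true  | e , true-e , inj-e = e⁺ , true-e⁺ , inj-e⁺
  where
  e⁺ : Fin (suc (count n (N ∘ suc))) → Fin (suc n)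
  e⁺ zero    = zero
  e⁺ (suc i) = suc (e i)
  true-e⁺ : ∀ i → N (e⁺ i) ≡ true
  true-e⁺ zero    = N₀
  true-e⁺ (suc i) = true-e i
  inj-e⁺ : ∀ i j → e⁺ i ≡ e⁺ j → i ≡ j
  inj-e⁺ zero    zero    eq = refl
  inj-e⁺ (suc i) (suc j) eq = cong suc (inj-e i j (suc-injective eq))

count+count-not : ∀ n N → count n N ℕ.+ count n (not ∘ N) ≡ n
count+count-not zero    N = refl
count+count-not (suc n) N with N zero
... | true  = cong suc (count+count-not n (N ∘ suc))
... | false = trans (ℕ.+-suc _ _) (cong suc (count+count-not n (N ∘ suc)))

combination : ∀ {n} k → (Fin k → ℚ) → (Fin k → Point n) → Point n
combination k μ p t = sumℚ k λ i → μ i * p i t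

-- Gaussian elimination, one coordinate at a time: coordinates outside `N` impose no condition, and
-- each coordinate in `N` uses up at most one vector as a pivot, so a vector remains.
dependent : ∀ n k (p : Fin k → Point n) (N : Fin n → Bool) → count n N ℕ.< k →
  Σ (Fin k → ℚ) λ μ → (∀ t → N t ≡ true → combination k μ p t ≡ 0ℚ) × ∃ λ i → μ i ≢ 0ℚ
dependent zero    (suc k) p N N<k = (λ _ → 1ℚ) , (λ ()) , zero , λ ()
dependent (suc n) k p N N<k with N zero in N₀
... | false with dependent n k (λ i → p i ∘ suc) (N ∘ suc) N<k
...   | μ , vanish , μ≢0 = μ , vanish⁺ , μ≢0
  where
  vanish⁺ : ∀ t → N t ≡ true → combination k μ p t ≡ 0ℚ
  vanish⁺ zero    Nt with () ← trans (≡-sym N₀) Nt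
  vanish⁺ (suc t) Nt = vanish t Nt
dependent (suc n) (suc k) p N N<k | true with any? (λ i → ¬? (p i zero ℚ.≟ 0ℚ))
-- Every vector vanishes at this coordinate, so the condition there holds for any weights and no
-- vector is spent.
... | no ¬pivot with dependent n (suc k) (λ i → p i ∘ suc) (N ∘ suc) (ℕ.<⇒≤ N<k)
...   | μ , vanish , μ≢0 = μ , vanish⁺ , μ≢0
  where
  vanish⁺ : ∀ t → N t ≡ true → combination (suc k) μ p t ≡ 0ℚ
  vanish⁺ zero    _  = trans (sumℚ-cong (suc k) λ i → trans
      (cong (μ i *_) (decidable-stable (p i zero ℚ.≟ 0ℚ) λ ≢0 → ¬pivot (i , ≢0)))
      (ℚ.*-zeroʳ (μ i)))
    (sumℚ-zero (suc k))
  vanish⁺ (suc t) Nt = vanish t Nt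
dependent (suc n) (suc k) p N N<k | true | yes (i , pᵢ≢0) = step (dependent n k q (N ∘ suc) (ℕ.s<s⁻¹ N<k))
  where
  instance _ = ℚ.≢-nonZero pᵢ≢0
  -- `r j` is the multiple of the pivot vector whose subtraction clears coordinate `zero`.
  r : Fin k → ℚ
  r j = p (punchIn i j) zero * ℚ.1/ p i zero
  q : Fin k → Point n
  q j t = p (punchIn i j) (suc t) - r j * p i (suc t)

  q₀ : ∀ j → p (punchIn i j) zero - r j * p i zero ≡ 0ℚ
  q₀ j = begin
    a - a * (ℚ.1/ p i zero) * p i zero    ≡⟨ cong (λ z → a - z) (ℚ.*-assoc a (ℚ.1/ p i zero) (p i zero)) ⟩
    a - a * ((ℚ.1/ p i zero) * p i zero)  ≡⟨ cong (λ z → a - a * z) (ℚ.*-inverseˡ (p i zero)) ⟩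
    a - a * 1ℚ                            ≡⟨ solve 1 (λ a → a :- a :* con 1ℚ := con 0ℚ) refl a ⟩
    0ℚ                                    ∎
    where
    open ≡-Reasoning
    a = p (punchIn i j) zero

  step : (Σ (Fin k → ℚ) λ μ → (∀ t → N (suc t) ≡ true → combination k μ q t ≡ 0ℚ) × ∃ λ i → μ i ≢ 0ℚ) →
    Σ (Fin (suc k) → ℚ) λ μ → (∀ t → N t ≡ true → combination (suc k) μ p t ≡ 0ℚ) × ∃ λ i → μ i ≢ 0ℚ
  step (μ , vanish , j , μj≢0) = μ⁺ , vanish⁺ , punchIn i j ,
    λ eq → μj≢0 (trans (≡-sym (insertAt-punchIn μ i μᵢ j)) eq)
    where
    -- The pivot's weight collects all the subtracted multiples, so that the combination of the
    -- original vectors equals that of the reduced ones.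
    μᵢ : ℚ
    μᵢ = - 1ℚ * sumℚ k (λ j → μ j * r j)
    μ⁺ : Fin (suc k) → ℚ
    μ⁺ = insertAt μ i μᵢ
    eliminate : ∀ t → combination (suc k) μ⁺ p t ≡
      sumℚ k λ j → μ j * (p (punchIn i j) t - r j * p i t)
    eliminate t = begin
      combination (suc k) μ⁺ p t
        ≡⟨ sumℚ-remove k (λ j → μ⁺ j * p j t) i ⟩
      μ⁺ i * p i t + sumℚ k (λ j → μ⁺ (punchIn i j) * p (punchIn i j) t)
        ≡⟨ cong₂ _+_ (cong (_* p i t) (insertAt-lookup μ i μᵢ))
             (sumℚ-cong k λ j → cong (_* p (punchIn i j) t) (insertAt-punchIn μ i μᵢ j)) ⟩
      μᵢ * p i t + A
        ≡⟨ solve 3 (λ s z A → (:- con 1ℚ :* s) :* z :+ A := A :+ (:- z) :* s) refl (sumℚ k (λ j → μ j * r j)) (p i t) A ⟩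
      A + (- p i t) * sumℚ k (λ j → μ j * r j)
        ≡⟨ sumℚ-linear k (λ j → μ j * p (punchIn i j) t) (- p i t) (λ j → μ j * r j) ⟨
      sumℚ k (λ j → μ j * p (punchIn i j) t + (- p i t) * (μ j * r j))
        ≡⟨ sumℚ-cong k (λ j → solve 4 (λ m a z r → m :* a :+ (:- z) :* (m :* r) := m :* (a :- r :* z)) refl
             (μ j) (p (punchIn i j) t) (p i t) (r j)) ⟩
      sumℚ k (λ j → μ j * (p (punchIn i j) t - r j * p i t)) ∎
      where
      open ≡-Reasoning
      A = sumℚ k (λ j → μ j * p (punchIn i j) t)
    vanish⁺ : ∀ t → N t ≡ true → combination (suc k) μ⁺ p t ≡ 0ℚ
    vanish⁺ zero    _  = trans (eliminate zero)
      (trans (sumℚ-cong k λ j → trans (cong (μ j *_) (q₀ j)) (ℚ.*-zeroʳ (μ j))) (sumℚ-zero k))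
    vanish⁺ (suc t) Nt = trans (eliminate (suc t)) (vanish t Nt)

-- Closed sets and layers

does⇒ : ∀ {P : Set} (P? : Dec P) → does P? ≡ true → P
does⇒ (yes p) _ = p

⟪_⟫ : ∀ {n} {P : Fin n → Set} → (∀ v → Dec (P v)) → Subset n
⟪ P? ⟫ = tabulate (does ∘ P?)

∈⟪⟫⁺ : ∀ {n} {P : Fin n → Set} (P? : ∀ v → Dec (P v)) {v} → P v → v ∈ ⟪ P? ⟫
∈⟪⟫⁺ P? {v} Pv = lookup⇒[]= v _ (trans (lookup∘tabulate _ v) (dec-true (P? v) Pv))

∈⟪⟫⁻ : ∀ {n} {P : Fin n → Set} (P? : ∀ v → Dec (P v)) {v} → v ∈ ⟪ P? ⟫ → P v
∈⟪⟫⁻ P? {v} v∈ = does⇒ (P? v) (trans (≡-sym (lookup∘tabulate (does ∘ P?) v)) ([]=⇒lookup v∈))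

∉⇒lookup : ∀ {n} {u} {S : Subset n} → u ∉ S → lookup S u ≡ false
∉⇒lookup {u = u} {S} u∉S with lookup S u in Su
... | true  = ⊥-elim (u∉S (lookup⇒[]= u S Su))
... | false = refl

ClosedUnder : ∀ {n} → (Fin n → Fin n → Set) → Subset n → Set
ClosedUnder R S = ∀ u v → R u v → v ∈ S → u ∈ S

closed? : ∀ {n} {R : Fin n → Fin n → Set} → (∀ u v → Dec (R u v)) → ∀ S →
  ClosedUnder R S ⊎ ∃ λ u → ∃ λ v → R u v × v ∈ S × u ∉ S
closed? R? S with any? (λ u → any? λ v → R? u v ×-dec (v ∈? S) ×-dec ¬? (u ∈? S))
... | yes bad = inj₂ bad
... | no ¬bad = inj₁ λ u v Ruv v∈S → decidable-stable (u ∈? S) λ u∉S → ¬bad (u , v , Ruv , v∈S , u∉S)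

closed-Star : ∀ {n} {R : Fin n → Fin n → Set} {S} → ClosedUnder R S →
  ∀ {u v} → Star R u v → v ∈ S → u ∈ S
closed-Star closed ε         v∈S = v∈S
closed-Star closed (r ◅ rs) v∈S = closed _ _ r (closed-Star closed rs v∈S)

abstract
  -- Starting from the singleton of `v`, predecessors that violate closedness are added one by one;
  -- each comes with a path to `v`, and the growth stops because the vertex set is finite.
  downset : ∀ {n} {R : Fin n → Fin n → Set} → (∀ u v → Dec (R u v)) → ∀ v →
    Σ (Subset n) λ S → ClosedUnder R S × v ∈ S × (∀ u → u ∈ S → Star R u v)
  downset {n} {R} R? v = grow ⁅ v ⁆ (⊃-wellFounded _) (x∈⁅x⁆ v) λ u u∈ →
    subst (λ w → Star R w v) (≡-sym (x∈⁅y⁆⇒x≡y v u∈)) ε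
    where
    grow : ∀ S → Acc _⊃_ S → v ∈ S → (∀ u → u ∈ S → Star R u v) →
      Σ (Subset n) λ S → ClosedUnder R S × v ∈ S × (∀ u → u ∈ S → Star R u v)
    grow S (acc rec) v∈S S↓ with closed? R? S
    ... | inj₁ closed = S , closed , v∈S , S↓
    ... | inj₂ (u , w , Ruw , w∈S , u∉S) = grow (S ∪ ⁅ u ⁆)
      (rec ((λ x∈S → x∈p∪q⁺ (inj₁ x∈S)) , u , x∈p∪q⁺ (inj₂ (x∈⁅x⁆ u)) , u∉S))
      (x∈p∪q⁺ (inj₁ v∈S))
      λ x x∈ → [ S↓ x , (λ x∈u → subst (λ y → Star R y v) (≡-sym (x∈⁅y⁆⇒x≡y u x∈u)) (Ruw ◅ S↓ w w∈S)) ]′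
        (x∈p∪q⁻ S ⁅ u ⁆ x∈)

argmax : ∀ n (c : Point n) {P : Fin n → Set} → (∀ v → Dec (P v)) →
  (∀ v → ¬ P v) ⊎ ∃ λ v → P v × (∀ u → P u → c u ≤ c v)
argmax zero    c P? = inj₁ λ ()
argmax (suc n) c P? with P? zero | argmax n (c ∘ suc) (P? ∘ suc)
... | no ¬P₀ | inj₁ ¬P = inj₁ λ { zero → ¬P₀ ; (suc v) → ¬P v }
... | no ¬P₀ | inj₂ (v , Pv , max) = inj₂ (suc v , Pv ,
  λ { zero P₀ → ⊥-elim (¬P₀ P₀) ; (suc u) → max u })
... | yes P₀ | inj₁ ¬P = inj₂ (zero , P₀ ,
  λ { zero _ → ℚ.≤-refl ; (suc u) Pu → ⊥-elim (¬P u Pu) })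
... | yes P₀ | inj₂ (v , Pv , max) with ℚ.≤-total (c zero) (c (suc v))
...   | inj₁ c₀≤ = inj₂ (suc v , Pv , λ { zero _ → c₀≤ ; (suc u) → max u })
...   | inj₂ ≤c₀ = inj₂ (zero , P₀ , λ { zero _ → ℚ.≤-refl ; (suc u) Pu → ℚ.≤-trans (max u Pu) ≤c₀ })

-- Lowering the top layer {c = m} of c to the next value m′ decreases the set {c < m}.
layer-induction : ∀ {n} (Q : Point n → Set) →
  (∀ c m → (∀ v → c v ≡ m) → Q c) →
  (∀ c m m′ → m′ ≤ m → (∀ v → c v ≤ m) → (∀ v → c v < m → c v ≤ m′) → Q (λ v → c v ⊓ m′) → Q c) →
  ∀ c → Q c
layer-induction {n} Q constant layer c with argmax n c {λ _ → Unit} (λ _ → yes tt)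
-- Without vertices `c` is vacuously constant, and the value 0 is arbitrary.
... | inj₁ empty = constant c 0ℚ λ v → ⊥-elim (empty v _)
... | inj₂ (v₀ , _ , c≤) = descend c (c v₀) (λ v → c≤ v _) (⊂-wellFounded _)
  where
  below? : ∀ (c : Point n) m v → Dec (c v < m)
  below? c m v = c v ℚ.<? m
  descend : ∀ c m → (∀ v → c v ≤ m) → Acc _⊂_ ⟪ below? c m ⟫ → Q c
  descend c m c≤m (acc rec) with argmax n c (below? c m)
  ... | inj₁ top = constant c m λ v → ℚ.≤-antisym (c≤m v) (ℚ.≮⇒≥ (top v))
  -- `v₁` has the largest value below `m`. Truncating there moves it into the new top layer, which
  -- makes the descent strict.
  ... | inj₂ (v₁ , v₁<m , next) = layer c m m′ (ℚ.<⇒≤ v₁<m) c≤m next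
    (descend c′ m′ (λ v → ℚ.p⊓q≤q (c v) m′)
      (rec ((λ {v} v∈ → ∈⟪⟫⁺ (below? c m) (ℚ.<-trans (low v (∈⟪⟫⁻ (below? c′ m′) v∈)) v₁<m))
        , v₁ , ∈⟪⟫⁺ (below? c m) v₁<m
        , λ v₁∈ → ℚ.<-irrefl refl (low v₁ (∈⟪⟫⁻ (below? c′ m′) v₁∈)))))
    where
    m′ = c v₁
    c′ : Point n
    c′ v = c v ⊓ m′
    low : ∀ v → c v ⊓ m′ < m′ → c v < m′
    low v lt with ℚ.≤-total (c v) m′
    ... | inj₁ c≤ = subst (_< m′) (ℚ.p≤q⇒p⊓q≡p c≤) lt
    ... | inj₂ c≥ = ⊥-elim (ℚ.<-irrefl (ℚ.p≥q⇒p⊓q≡q c≥) lt)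

-- The minimum of the positive values and 1; the cap supplies a bound when no value is positive.
gap : ∀ n (g : Point n) → ∃ λ e → 0ℚ < e × (∀ i → 0ℚ < g i → e ≤ g i)
gap zero    g = 1ℚ , ℚ.positive⁻¹ 1ℚ , λ ()
gap (suc n) g with gap n (g ∘ suc) | 0ℚ ℚ.<? g zero
... | e , 0<e , e≤ | no ¬0< = e , 0<e , λ { zero 0< → ⊥-elim (¬0< 0<) ; (suc i) → e≤ i }
... | e , 0<e , e≤ | yes 0<g with ℚ.≤-total e (g zero)
...   | inj₁ e≤g = e , 0<e , λ { zero _ → e≤g ; (suc i) → e≤ i }
...   | inj₂ g≤e = g zero , 0<g , λ { zero _ → ℚ.≤-refl ; (suc i) 0< → ℚ.≤-trans g≤e (e≤ i 0<) }

gap₂ : ∀ m n (g : Fin m → Point n) → ∃ λ e → 0ℚ < e × (∀ i j → 0ℚ < g i j → e ≤ g i j)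
gap₂ m n g with gap m (λ i → proj₁ (gap n (g i)))
... | e , 0<e , e≤ = e , 0<e , λ i j 0<g →
  ℚ.≤-trans (e≤ i (proj₁ (proj₂ (gap n (g i))))) (proj₂ (proj₂ (gap n (g i))) j 0<g)

-- Edge sums and the rank function

𝟙 : Bool → ℚ
𝟙 true  = 1ℚ
𝟙 false = 0ℚ

indicator : ∀ {n} → Subset n → Point n
indicator S v = 𝟙 (lookup S v)

sumOver≡dot : ∀ {n} (S : Subset n) x → sumOver S x ≡ dot (indicator S) x
sumOver≡dot {n} S x = sumℚ-cong n λ v → if≡𝟙* (lookup S v) (x v)
  where
  if≡𝟙* : ∀ b y → (if b then y else 0ℚ) ≡ 𝟙 b * y
  if≡𝟙* true  y = ≡-sym (ℚ.*-identityˡ y)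
  if≡𝟙* false y = ≡-sym (ℚ.*-zeroˡ y)

dot-congˡ : ∀ {n} {a b : Point n} x → (∀ v → a v ≡ b v) → dot a x ≡ dot b x
dot-congˡ {n} x a≡b = sumℚ-cong n λ v → cong (_* x v) (a≡b v)

dot-linearˡ : ∀ {n} (a b : Point n) t x → dot (λ v → a v + t * b v) x ≡ dot a x + t * dot b x
dot-linearˡ {n} a b t x = trans
  (sumℚ-cong n λ v → solve 4 (λ a t b x → (a :+ t :* b) :* x := a :* x :+ t :* (b :* x)) refl (a v) t (b v) (x v))
  (sumℚ-linear n (λ v → a v * x v) t (λ v → b v * x v))

dot-linearʳ : ∀ {n} (a x y : Point n) t → dot a (λ v → x v + t * y v) ≡ dot a x + t * dot a y
dot-linearʳ {n} a x y t = trans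
  (sumℚ-cong n λ v → solve 4 (λ a t x y → a :* (x :+ t :* y) := a :* x :+ t :* (a :* y)) refl (a v) t (x v) (y v))
  (sumℚ-linear n (λ v → a v * x v) t (λ v → a v * y v))

indicator-⊤ : ∀ {n} (v : Fin n) → indicator ⊤ v ≡ 1ℚ
indicator-⊤ v = cong 𝟙 (lookup-replicate v true)

dot-⊤ : ∀ {n} (x : Point n) → dot (indicator ⊤) x ≡ sumℚ n x
dot-⊤ {n} x = sumℚ-cong n λ v → trans (cong (_* x v) (indicator-⊤ v)) (ℚ.*-identityˡ (x v))

ℕ→ℚ-∣∣ : ∀ {m} (S : Subset m) → ℕ→ℚ ∣ S ∣ ≡ sumℚ m (indicator S)
ℕ→ℚ-∣∣ []          = refl
ℕ→ℚ-∣∣ (true ∷ S)  = trans (ℕ→ℚ-+ 1 ∣ S ∣) (cong (1ℚ +_) (ℕ→ℚ-∣∣ S))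
ℕ→ℚ-∣∣ (false ∷ S) = trans (ℕ→ℚ-∣∣ S) (≡-sym (ℚ.+-identityˡ (sumℚ _ (indicator S))))

-- Marks of edges and the shares they assign

flip : Mark → Mark
flip und = und
flip fwd = bwd
flip bwd = fwd

-- Orientations are stored for increasing pairs only; this reads them along any ordered pair. The
-- diagonal value is a filler, since adjacent vertices are distinct.
mark : ∀ {n} → Orientation n → Fin n → Fin n → Mark
mark O u v with Fin.<-cmp u v
... | tri< _ _ _ = O u v
... | tri≈ _ _ _ = und
... | tri> _ _ _ = flip (O v u)

mark-< : ∀ {n} (O : Orientation n) {i j} → i Fin.< j → mark O i j ≡ O i j
mark-< O {i} {j} i<j with Fin.<-cmp i j
... | tri< _ _ _ = refl
... | tri≈ ¬< _ _ = ⊥-elim (¬< i<j)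
... | tri> ¬< _ _ = ⊥-elim (¬< i<j)

mark-> : ∀ {n} (O : Orientation n) {i j} → i Fin.< j → mark O j i ≡ flip (O i j)
mark-> O {i} {j} i<j with Fin.<-cmp j i
... | tri< _ _ ¬> = ⊥-elim (¬> i<j)
... | tri≈ _ _ ¬> = ⊥-elim (¬> i<j)
... | tri> _ _ _ = refl

-- The share of an edge uv received by v, where the mark is read from u to v.
share : Mark → ℚ
share und = ½
share fwd = 1ℚ
share bwd = 0ℚ

-- The contribution of one edge to the pairing of a functional with the center, where `a` and `b`
-- are the values of the functional at its ends.
split : Mark → ℚ → ℚ → ℚ
split und a b = ½ * (a + b)
split fwd a b = b
split bwd a b = a

share-split : ∀ m a b → b * share m + 1ℚ * (a * share (flip m)) ≡ split m a b
share-split und a b = solve 2 (λ a b → b :* con ½ :+ con 1ℚ :* (a :* con ½) := con ½ :* (a :+ b)) refl a b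
share-split fwd a b = solve 2 (λ a b → b :* con 1ℚ :+ con 1ℚ :* (a :* con 0ℚ) := b) refl a b
share-split bwd a b = solve 2 (λ a b → b :* con 0ℚ :+ con 1ℚ :* (a :* con 1ℚ) := a) refl a b

split-diagonal : ∀ m a → split m a a ≡ a
split-diagonal und a = solve 1 (λ a → con ½ :* (a :+ a) := a) refl a
split-diagonal fwd a = refl
split-diagonal bwd a = refl

-- The surplus over f(S) that one edge contributes at the center, given whether its ends lie in S.
splitExcess : Mark → Bool → Bool → ℚ
splitExcess m s t = split m (𝟙 s) (𝟙 t) - 𝟙 (s ∧ t)

splitExcess-nonNeg : ∀ m s t → 0ℚ ≤ splitExcess m s t
splitExcess-nonNeg und true  true  = toWitness {a? = 0ℚ ℚ.≤? splitExcess und true true} _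
splitExcess-nonNeg und true  false = toWitness {a? = 0ℚ ℚ.≤? splitExcess und true false} _
splitExcess-nonNeg und false true  = toWitness {a? = 0ℚ ℚ.≤? splitExcess und false true} _
splitExcess-nonNeg und false false = toWitness {a? = 0ℚ ℚ.≤? splitExcess und false false} _
splitExcess-nonNeg fwd true  true  = toWitness {a? = 0ℚ ℚ.≤? splitExcess fwd true true} _
splitExcess-nonNeg fwd true  false = toWitness {a? = 0ℚ ℚ.≤? splitExcess fwd true false} _
splitExcess-nonNeg fwd false true  = toWitness {a? = 0ℚ ℚ.≤? splitExcess fwd false true} _
splitExcess-nonNeg fwd false false = toWitness {a? = 0ℚ ℚ.≤? splitExcess fwd false false} _
splitExcess-nonNeg bwd true  true  = toWitness {a? = 0ℚ ℚ.≤? splitExcess bwd true true} _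
splitExcess-nonNeg bwd true  false = toWitness {a? = 0ℚ ℚ.≤? splitExcess bwd true false} _
splitExcess-nonNeg bwd false true  = toWitness {a? = 0ℚ ℚ.≤? splitExcess bwd false true} _
splitExcess-nonNeg bwd false false = toWitness {a? = 0ℚ ℚ.≤? splitExcess bwd false false} _

-- An edge that violates closedness has surplus 1 if it is directed and ½ if it is not; this is the
-- source of the slack ½.
splitExcess-into : ∀ m → m ≢ bwd → ½ ≤ splitExcess m false true
splitExcess-into und _ = toWitness {a? = ½ ℚ.≤? splitExcess und false true} _
splitExcess-into fwd _ = toWitness {a? = ½ ℚ.≤? splitExcess fwd false true} _
splitExcess-into bwd ≢bwd = ⊥-elim (≢bwd refl)

splitExcess-from : ∀ m → flip m ≢ bwd → ½ ≤ splitExcess m true false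
splitExcess-from und _ = toWitness {a? = ½ ℚ.≤? splitExcess und true false} _
splitExcess-from fwd ≢bwd = ⊥-elim (≢bwd refl)
splitExcess-from bwd _ = toWitness {a? = ½ ℚ.≤? splitExcess bwd true false} _

split-tight : ∀ m s t → (m ≢ bwd → t ≡ true → s ≡ true) → (flip m ≢ bwd → s ≡ true → t ≡ true) →
  split m (𝟙 s) (𝟙 t) ≡ 𝟙 (s ∧ t)
split-tight m   true  true  _  _  = split-diagonal m 1ℚ
split-tight m   false false _  _  = split-diagonal m 0ℚ
split-tight und true  false _  to with () ← to (λ ()) refl
split-tight fwd true  false _  _  = refl
split-tight bwd true  false _  to with () ← to (λ ()) refl
split-tight und false true  fr _  with () ← fr (λ ()) refl
split-tight fwd false true  fr _  with () ← fr (λ ()) refl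
split-tight bwd false true  _  _  = refl

_≟ₘ_ : ∀ (m m′ : Mark) → Dec (m ≡ m′)
und ≟ₘ und = yes refl
und ≟ₘ fwd = no λ ()
und ≟ₘ bwd = no λ ()
fwd ≟ₘ und = no λ ()
fwd ≟ₘ fwd = yes refl
fwd ≟ₘ bwd = no λ ()
bwd ≟ₘ und = no λ ()
bwd ≟ₘ fwd = no λ ()
bwd ≟ₘ bwd = yes refl

module _ {n : ℕ} (G : Graph n) where

  edge : Fin n → Fin n → Bool
  edge i j = does (i <? j) ∧ adj G i j

  edge⁻ : ∀ {i j} → edge i j ≡ true → i Fin.< j × Adj G i j
  edge⁻ {i} {j} = does-∧⁻ (i <? j) (adj G i j)
    where
    does-∧⁻ : ∀ {P : Set} (P? : Dec P) b → does P? ∧ b ≡ true → P × b ≡ true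
    does-∧⁻ (yes p) b eq = p , eq

  edge⁺ : ∀ {i j} → i Fin.< j → Adj G i j → edge i j ≡ true
  edge⁺ {i} {j} i<j ij = cong₂ _∧_ (dec-true (i <? j) i<j) ij

  Adj-sym : ∀ {u v} → Adj G u v → Adj G v u
  Adj-sym {u} {v} uv = trans (Graph.sym G v u) uv

  Adj⇒≢ : ∀ {u v} → Adj G u v → u ≢ v
  Adj⇒≢ {u} uv refl with () ← trans (≡-sym uv) (irrefl G u)

  edgeSum : (Fin n → Fin n → ℚ) → ℚ
  edgeSum g = sumℚ n λ i → sumℚ n λ j → if edge i j then g i j else 0ℚ

  edgeSum-cong : ∀ {g h} → (∀ i j → i Fin.< j → Adj G i j → g i j ≡ h i j) → edgeSum g ≡ edgeSum h
  edgeSum-cong {g} {h} g≡h = sumℚ-cong n λ i → sumℚ-cong n λ j → at i j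
    where
    at : ∀ i j → (if edge i j then g i j else 0ℚ) ≡ (if edge i j then h i j else 0ℚ)
    at i j with edge i j in ij
    ... | true  = g≡h i j (proj₁ (edge⁻ ij)) (proj₂ (edge⁻ ij))
    ... | false = refl

  edgeSum-mono : ∀ {g h} → (∀ i j → i Fin.< j → Adj G i j → g i j ≤ h i j) → edgeSum g ≤ edgeSum h
  edgeSum-mono {g} {h} g≤h = sumℚ-mono n λ i → sumℚ-mono n λ j → at i j
    where
    at : ∀ i j → (if edge i j then g i j else 0ℚ) ≤ (if edge i j then h i j else 0ℚ)
    at i j with edge i j in ij
    ... | true  = g≤h i j (proj₁ (edge⁻ ij)) (proj₂ (edge⁻ ij))
    ... | false = ℚ.≤-refl

  edgeSum-linear : ∀ a t b → edgeSum (λ i j → a i j + t * b i j) ≡ edgeSum a + t * edgeSum b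
  edgeSum-linear a t b = begin
    edgeSum (λ i j → a i j + t * b i j)
      ≡⟨ (sumℚ-cong n λ i → sumℚ-cong n λ j → at (edge i j) (a i j) (b i j)) ⟩
    sumℚ n (λ i → sumℚ n (λ j → A i j + t * B i j))
      ≡⟨ sumℚ-cong n (λ i → sumℚ-linear n (A i) t (B i)) ⟩
    sumℚ n (λ i → sumℚ n (A i) + t * sumℚ n (B i))
      ≡⟨ sumℚ-linear n (λ i → sumℚ n (A i)) t (λ i → sumℚ n (B i)) ⟩
    edgeSum a + t * edgeSum b ∎
    where
    open ≡-Reasoning
    A B : Fin n → Fin n → ℚ
    A i j = if edge i j then a i j else 0ℚ
    B i j = if edge i j then b i j else 0ℚ
    at : ∀ e a b → (if e then a + t * b else 0ℚ) ≡ (if e then a else 0ℚ) + t * (if e then b else 0ℚ)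
    at true  a b = refl
    at false a b = solve 1 (λ t → con 0ℚ := con 0ℚ :+ t :* con 0ℚ) refl t

  edgeSum-zero : edgeSum (λ _ _ → 0ℚ) ≡ 0ℚ
  edgeSum-zero = trans (sumℚ-cong n λ i → trans (sumℚ-cong n λ j → at (edge i j)) (sumℚ-zero n)) (sumℚ-zero n)
    where
    at : ∀ e → (if e then 0ℚ else 0ℚ) ≡ 0ℚ
    at true  = refl
    at false = refl

  single≤edgeSum : ∀ g → (∀ i j → 0ℚ ≤ g i j) → ∀ {i j} → i Fin.< j → Adj G i j → g i j ≤ edgeSum g
  single≤edgeSum g 0≤g {i} {j} i<j ij = begin
    g i j                                        ≡⟨ cong (λ e → if e then g i j else 0ℚ) (edge⁺ i<j ij) ⟨
    term i j                                     ≤⟨ single≤sumℚ n (term i) j (nonNeg i) ⟩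
    sumℚ n (term i)                              ≤⟨ single≤sumℚ n (λ i → sumℚ n (term i)) i row-nonNeg ⟩
    edgeSum g                                    ∎
    where
    open ℚ.≤-Reasoning
    term : Fin n → Fin n → ℚ
    term i j = if edge i j then g i j else 0ℚ
    nonNeg : ∀ i j → 0ℚ ≤ term i j
    nonNeg i j with edge i j
    ... | true  = 0≤g i j
    ... | false = ℚ.≤-refl
    row-nonNeg : ∀ i → 0ℚ ≤ sumℚ n (term i)
    row-nonNeg i = ℚ.≤-trans (ℚ.≤-reflexive (≡-sym (sumℚ-zero n))) (sumℚ-mono n (nonNeg i))

  -- Double counting: each edge is met once from either end. The factor `1ℚ` gives the summand the
  -- shape that `edgeSum-linear` expects.
  sum-over-neighbours : ∀ (g : Fin n → Fin n → ℚ) →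
    sumℚ n (λ v → sumℚ n λ u → if adj G u v then g u v else 0ℚ) ≡ edgeSum λ i j → g i j + 1ℚ * g j i
  sum-over-neighbours g = begin
    sumℚ n (λ v → sumℚ n λ u → if adj G u v then g u v else 0ℚ)
      ≡⟨ (sumℚ-cong n λ v → sumℚ-cong n λ u → at u v (g u v)) ⟩
    sumℚ n (λ v → sumℚ n λ u → A u v + B u v)
      ≡⟨ sumℚ-cong n (λ v → sumℚ-+ n (λ u → A u v) (λ u → B u v)) ⟩
    sumℚ n (λ v → sumℚ n (λ u → A u v) + sumℚ n (λ u → B u v))
      ≡⟨ sumℚ-+ n (λ v → sumℚ n (λ u → A u v)) (λ v → sumℚ n (λ u → B u v)) ⟩
    sumℚ n (λ v → sumℚ n (λ u → A u v)) + sumℚ n (λ v → sumℚ n (λ u → B u v))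
      ≡⟨ cong₂ _+_ (sumℚ-swap n n (λ v u → A u v)) (≡-sym (ℚ.*-identityˡ (edgeSum λ i j → g j i))) ⟩
    edgeSum g + 1ℚ * edgeSum (λ i j → g j i)
      ≡⟨ edgeSum-linear g 1ℚ (λ i j → g j i) ⟨
    edgeSum (λ i j → g i j + 1ℚ * g j i) ∎
    where
    open ≡-Reasoning
    A B : Fin n → Fin n → ℚ
    A u v = if edge u v then g u v else 0ℚ
    B u v = if edge v u then g u v else 0ℚ
    at : ∀ u v y → (if adj G u v then y else 0ℚ) ≡ (if edge u v then y else 0ℚ) + (if edge v u then y else 0ℚ)
    at u v y rewrite Graph.sym G v u with adj G u v in uv
    ... | false rewrite ∧-zeroʳ (does (u <? v)) | ∧-zeroʳ (does (v <? u)) = refl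
    ... | true with Fin.<-cmp u v
    ...   | tri< u<v _ v≮u rewrite dec-true (u <? v) u<v | dec-false (v <? u) v≮u = ≡-sym (ℚ.+-identityʳ y)
    ...   | tri≈ _ u≡v _ = ⊥-elim (Adj⇒≢ uv u≡v)
    ...   | tri> u≮v _ v<u rewrite dec-false (u <? v) u≮v | dec-true (v <? u) v<u = ≡-sym (ℚ.+-identityˡ y)

  -- The function f, written with rational sums so that their linearity applies to it.
  rank : Subset n → ℚ
  rank S = sumℚ n (indicator S) + edgeSum λ i j → 𝟙 (lookup S i ∧ lookup S j)

  ℕ→ℚ-edgesIn : ∀ S → ℕ→ℚ (edgesIn G S) ≡ edgeSum λ i j → 𝟙 (lookup S i ∧ lookup S j)
  ℕ→ℚ-edgesIn S = trans (ℕ→ℚ-sum n _) (sumℚ-cong n λ i → trans (ℕ→ℚ-sum n _)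
    (sumℚ-cong n λ j → at (does (i <? j)) (adj G i j) (lookup S i ∧ lookup S j)))
    where
    at : ∀ a b c → ℕ→ℚ (if a ∧ b ∧ c then 1 else 0) ≡ (if a ∧ b then 𝟙 c else 0ℚ)
    at true  true  true  = refl
    at true  true  false = refl
    at true  false _     = refl
    at false _     _     = refl

  ℕ→ℚ-rank : ∀ S → ℕ→ℚ (∣ S ∣ ℕ.+ edgesIn G S) ≡ rank S
  ℕ→ℚ-rank S = trans (ℕ→ℚ-+ ∣ S ∣ (edgesIn G S)) (cong₂ _+_ (ℕ→ℚ-∣∣ S) (ℕ→ℚ-edgesIn S))

  rank-⊤ : rank ⊤ ≡ sumℚ n (λ _ → 1ℚ) + edgeSum (λ _ _ → 1ℚ)
  rank-⊤ = cong₂ _+_ (sumℚ-cong n indicator-⊤)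
    (edgeSum-cong λ i j _ _ → cong₂ (λ s t → 𝟙 (s ∧ t)) (lookup-replicate i true) (lookup-replicate j true))

  Tight : Point n → Subset n → Set
  Tight x S = dot (indicator S) x ≡ rank S

  PG⁺ : ∀ {x} → Tight x ⊤ → (∀ S → rank S ≤ dot (indicator S) x) → PG G x
  PG⁺ {x} total bound =
    trans (≡-sym (dot-⊤ x)) (trans total (trans (≡-sym (ℕ→ℚ-rank ⊤)) (cong (λ k → ℕ→ℚ (k ℕ.+ numEdges G)) (∣⊤∣≡n n)))) ,
    λ S → ℚ.≤-trans (ℚ.≤-reflexive (ℕ→ℚ-rank S)) (ℚ.≤-trans (bound S) (ℚ.≤-reflexive (≡-sym (sumOver≡dot S x))))

  PG-total : ∀ {x} → PG G x → Tight x ⊤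
  PG-total {x} (total , _) = trans (dot-⊤ x) (trans total
    (trans (cong (λ k → ℕ→ℚ (k ℕ.+ numEdges G)) (≡-sym (∣⊤∣≡n n))) (ℕ→ℚ-rank ⊤)))

  PG-bound : ∀ {x} → PG G x → ∀ S → rank S ≤ dot (indicator S) x
  PG-bound {x} (_ , bound) S = ℚ.≤-trans (ℚ.≤-reflexive (≡-sym (ℕ→ℚ-rank S)))
    (ℚ.≤-trans (bound S) (ℚ.≤-reflexive (sumOver≡dot S x)))

-- The center of an orientation and the support function

module _ {n : ℕ} (G : Graph n) where

  -- An undirected edge counts in both directions, so that a set closed under this relation cannot
  -- cut through a block.
  Below : Orientation n → Fin n → Fin n → Set
  Below O u v = Adj G u v × mark O u v ≢ bwd

  below? : ∀ O u v → Dec (Below O u v)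
  below? O u v = (adj G u v Bool.≟ true) ×-dec ¬? (mark O u v ≟ₘ bwd)

  Closed : Orientation n → Subset n → Set
  Closed O = ClosedUnder (Below O)

  -- The summand 1 accounts for |S| in f(S), the shares for the edges.
  center : Orientation n → Point n
  center O v = 1ℚ + sumℚ n λ u → if adj G u v then share (mark O u v) else 0ℚ

  -- Collecting the shares by edges instead of by vertices, each edge gives each end's value times
  -- that end's share.
  dot-center : ∀ O c → dot c (center O) ≡ sumℚ n c + edgeSum G λ i j → split (O i j) (c i) (c j)
  dot-center O c = begin
    dot c (center O)
      ≡⟨ sumℚ-cong n (λ v → trans (ℚ.*-distribˡ-+ (c v) 1ℚ (sumℚ n (s v))) (cong₂ _+_ (ℚ.*-identityʳ (c v)) (weigh v))) ⟩
    sumℚ n (λ v → c v + sumℚ n λ u → if adj G u v then c v * share (mark O u v) else 0ℚ)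
      ≡⟨ sumℚ-+ n c (λ v → sumℚ n λ u → if adj G u v then c v * share (mark O u v) else 0ℚ) ⟩
    sumℚ n c + sumℚ n (λ v → sumℚ n λ u → if adj G u v then c v * share (mark O u v) else 0ℚ)
      ≡⟨ cong (sumℚ n c +_) (sum-over-neighbours G λ u v → c v * share (mark O u v)) ⟩
    sumℚ n c + edgeSum G (λ i j → c j * share (mark O i j) + 1ℚ * (c i * share (mark O j i)))
      ≡⟨ cong (sumℚ n c +_) (edgeSum-cong G λ i j i<j _ → trans
           (cong₂ (λ m m′ → c j * share m + 1ℚ * (c i * share m′)) (mark-< O i<j) (mark-> O i<j))
           (share-split (O i j) (c i) (c j))) ⟩
    sumℚ n c + edgeSum G (λ i j → split (O i j) (c i) (c j)) ∎
    where
    open ≡-Reasoning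
    s : Fin n → Fin n → ℚ
    s v u = if adj G u v then share (mark O u v) else 0ℚ
    *-if : ∀ a b y → a * (if b then y else 0ℚ) ≡ (if b then a * y else 0ℚ)
    *-if a true  y = refl
    *-if a false y = ℚ.*-zeroʳ a
    weigh : ∀ v → c v * sumℚ n (s v) ≡ sumℚ n λ u → if adj G u v then c v * share (mark O u v) else 0ℚ
    weigh v = trans (≡-sym (sumℚ-*ˡ n (c v) (s v)))
      (sumℚ-cong n λ u → *-if (c v) (adj G u v) (share (mark O u v)))

  center-tight : ∀ O {S} → Closed O S → Tight G (center O) S
  center-tight O {S} closed = trans (dot-center O (indicator S))
    (cong (sumℚ n (indicator S) +_) (edgeSum-cong G λ i j i<j ij → split-tight (O i j) (lookup S i) (lookup S j)
      (λ m≢bwd Sj → []=⇒lookup (closed i j (ij , m≢bwd ∘ trans (≡-sym (mark-< O i<j))) (lookup⇒[]= j S Sj)))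
      (λ m≢bwd Si → []=⇒lookup (closed j i (Adj-sym G ij , m≢bwd ∘ trans (≡-sym (mark-> O i<j))) (lookup⇒[]= i S Si)))))

  center-excess : Orientation n → Subset n → ℚ
  center-excess O S = edgeSum G λ i j → splitExcess (O i j) (lookup S i) (lookup S j)

  dot-center-excess : ∀ O S → dot (indicator S) (center O) ≡ rank G S + center-excess O S
  dot-center-excess O S = begin
    dot (indicator S) (center O)
      ≡⟨ dot-center O (indicator S) ⟩
    σ + edgeSum G (λ i j → split (O i j) (𝟙 (lookup S i)) (𝟙 (lookup S j)))
      ≡⟨ cong (σ +_) (edgeSum-cong G λ i j _ _ → solve 2 (λ s e → s := e :+ con 1ℚ :* (s :- e)) refl
           (split (O i j) (𝟙 (lookup S i)) (𝟙 (lookup S j))) (𝟙 (lookup S i ∧ lookup S j))) ⟩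
    σ + edgeSum G (λ i j → 𝟙 (lookup S i ∧ lookup S j) + 1ℚ * splitExcess (O i j) (lookup S i) (lookup S j))
      ≡⟨ cong (σ +_) (edgeSum-linear G (λ i j → 𝟙 (lookup S i ∧ lookup S j)) 1ℚ
           (λ i j → splitExcess (O i j) (lookup S i) (lookup S j))) ⟩
    σ + (edgeSum G (λ i j → 𝟙 (lookup S i ∧ lookup S j)) + 1ℚ * center-excess O S)
      ≡⟨ solve 3 (λ σ e x → σ :+ (e :+ con 1ℚ :* x) := (σ :+ e) :+ x) refl
           σ (edgeSum G (λ i j → 𝟙 (lookup S i ∧ lookup S j))) (center-excess O S) ⟩
    rank G S + center-excess O S ∎
    where
    open ≡-Reasoning
    σ = sumℚ n (indicator S)

  center-bound : ∀ O S → rank G S ≤ dot (indicator S) (center O)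
  center-bound O S = begin
    rank G S                        ≡⟨ ℚ.+-identityʳ (rank G S) ⟨
    rank G S + 0ℚ                   ≡⟨ cong (rank G S +_) (edgeSum-zero G) ⟨
    rank G S + edgeSum G (λ _ _ → 0ℚ) ≤⟨ ℚ.+-monoʳ-≤ (rank G S) (edgeSum-mono G λ i j _ _ →
                                         splitExcess-nonNeg (O i j) (lookup S i) (lookup S j)) ⟩
    rank G S + center-excess O S    ≡⟨ dot-center-excess O S ⟨
    dot (indicator S) (center O)    ∎
    where open ℚ.≤-Reasoning

  -- No edge has negative surplus, so the violating edge alone already yields ½.
  center-slack : ∀ O S {u v} → Below O u v → v ∈ S → u ∉ S → rank G S + ½ ≤ dot (indicator S) (center O)
  center-slack O S {u} {v} (uv , m≢bwd) v∈S u∉S = ℚ.≤-trans (ℚ.+-monoʳ-≤ (rank G S) (½≤ (Fin.<-cmp u v)))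
    (ℚ.≤-reflexive (≡-sym (dot-center-excess O S)))
    where
    Sv = []=⇒lookup v∈S
    Su = ∉⇒lookup u∉S
    excess : Fin n → Fin n → ℚ
    excess i j = splitExcess (O i j) (lookup S i) (lookup S j)
    excess-nonNeg : ∀ i j → 0ℚ ≤ excess i j
    excess-nonNeg i j = splitExcess-nonNeg (O i j) (lookup S i) (lookup S j)
    ½≤ : Tri (u Fin.< v) (u ≡ v) (v Fin.< u) → ½ ≤ center-excess O S
    ½≤ (tri< u<v _ _) = ℚ.≤-trans
      (ℚ.≤-trans (splitExcess-into (O u v) (m≢bwd ∘ trans (mark-< O u<v)))
        (ℚ.≤-reflexive (cong₂ (splitExcess (O u v)) (≡-sym Su) (≡-sym Sv))))
      (single≤edgeSum G excess excess-nonNeg u<v uv)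
    ½≤ (tri≈ _ u≡v _) = ⊥-elim (Adj⇒≢ G uv u≡v)
    ½≤ (tri> _ _ v<u) = ℚ.≤-trans
      (ℚ.≤-trans (splitExcess-from (O v u) (m≢bwd ∘ trans (mark-> O v<u)))
        (ℚ.≤-reflexive (cong₂ (splitExcess (O v u)) (≡-sym Sv) (≡-sym Su))))
      (single≤edgeSum G excess excess-nonNeg v<u (Adj-sym G uv))

  tight⇒closed : ∀ O S → Tight G (center O) S → Closed O S
  tight⇒closed O S tight with closed? (below? O) S
  ... | inj₁ closed = closed
  ... | inj₂ (u , v , below , v∈S , u∉S) = ⊥-elim (ℚ.<-irrefl refl (begin-strict
    rank G S                     ≡⟨ ℚ.+-identityʳ (rank G S) ⟨
    rank G S + 0ℚ                <⟨ ℚ.+-monoʳ-< (rank G S) (ℚ.positive⁻¹ ½) ⟩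
    rank G S + ½                 ≤⟨ center-slack O S below v∈S u∉S ⟩
    dot (indicator S) (center O) ≡⟨ tight ⟩
    rank G S                     ∎))
    where open ℚ.≤-Reasoning

  center∈PG : ∀ O → PG G (center O)
  center∈PG O = PG⁺ G (center-tight O λ _ _ _ _ → ∈⊤) (center-bound O)

  face : Orientation n → Point n → Set
  face O x = PG G x × (∀ S → Closed O S → Tight G x S)

  center∈face : ∀ O → face O (center O)
  center∈face O = center∈PG O , λ S → center-tight O

  support : Point n → ℚ
  support c = sumℚ n c + edgeSum G λ i j → c i ⊔ c j

  excess : Point n → Subset n → ℚ
  excess x S = dot (indicator S) x - rank G S

  dot-one : ∀ {x} → Tight G x ⊤ → dot (λ _ → 1ℚ) x ≡ sumℚ n (λ _ → 1ℚ) + edgeSum G (λ _ _ → 1ℚ)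
  dot-one {x} total = trans (dot-congˡ x λ v → ≡-sym (indicator-⊤ v)) (trans total (rank-⊤ G))

  -- Both terms equal m f(V), where V is the whole vertex set. This is the base case of the Abel
  -- summation.
  support-constant : ∀ {x} → Tight G x ⊤ → ∀ c m → (∀ v → c v ≡ m) → support c - dot c x ≡ 0ℚ
  support-constant {x} total c m c≡m = begin
    support c - dot c x
      -- Writing m as `0ℚ + m * 1ℚ` brings the constant functional under the linearity lemmas.
      ≡⟨ cong₂ _-_ (cong₂ _+_ (sumℚ-cong n c≡) (edgeSum-cong G λ i j _ _ →
           trans (cong₂ _⊔_ (c≡m i) (c≡m j)) (trans (ℚ.⊔-idem m) (≡-sym 0+m*1≡m)))) (dot-congˡ x c≡) ⟩
    (sumℚ n (λ _ → 0ℚ + m * 1ℚ) + edgeSum G (λ _ _ → 0ℚ + m * 1ℚ)) - dot (λ _ → 0ℚ + m * 1ℚ) x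
      ≡⟨ cong₂ _-_ (cong₂ _+_ (sumℚ-linear n (λ _ → 0ℚ) m (λ _ → 1ℚ)) (edgeSum-linear G (λ _ _ → 0ℚ) m (λ _ _ → 1ℚ)))
           (dot-linearˡ (λ _ → 0ℚ) (λ _ → 1ℚ) m x) ⟩
    ((sumℚ n (λ _ → 0ℚ) + m * Σ1) + (edgeSum G (λ _ _ → 0ℚ) + m * E1)) - (dot (λ _ → 0ℚ) x + m * dot (λ _ → 1ℚ) x)
      ≡⟨ cong₂ _-_ (cong₂ (λ a b → (a + m * Σ1) + (b + m * E1)) (sumℚ-zero n) (edgeSum-zero G))
           (cong₂ (λ a b → a + m * b) dot-zero (dot-one total)) ⟩
    ((0ℚ + m * Σ1) + (0ℚ + m * E1)) - (0ℚ + m * (Σ1 + E1))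
      ≡⟨ solve 3 (λ m a b → ((con 0ℚ :+ m :* a) :+ (con 0ℚ :+ m :* b)) :- (con 0ℚ :+ m :* (a :+ b)) := con 0ℚ) refl m Σ1 E1 ⟩
    0ℚ ∎
    where
    open ≡-Reasoning
    Σ1 = sumℚ n (λ _ → 1ℚ)
    E1 = edgeSum G (λ _ _ → 1ℚ)
    0+m*1≡m : 0ℚ + m * 1ℚ ≡ m
    0+m*1≡m = solve 1 (λ m → con 0ℚ :+ m :* con 1ℚ := m) refl m
    c≡ : ∀ v → c v ≡ 0ℚ + m * 1ℚ
    c≡ v = trans (c≡m v) (≡-sym 0+m*1≡m)
    dot-zero : dot (λ _ → 0ℚ) x ≡ 0ℚ
    dot-zero = trans (sumℚ-cong n λ v → ℚ.*-zeroˡ (x v)) (sumℚ-zero n)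

  -- Raising the complement of L by t increases the support function by t (f(V) - f(L)) and the
  -- pairing with x by t (f(V) - x(L)). The difference of the two is t times the excess of x on L.
  support-layer : ∀ {x} → Tight G x ⊤ → ∀ c c′ t L →
    (∀ v → c v ≡ c′ v + t * (1ℚ + - 1ℚ * indicator L v)) →
    (∀ i j → c i ⊔ c j ≡ (c′ i ⊔ c′ j) + t * (1ℚ + - 1ℚ * 𝟙 (lookup L i ∧ lookup L j))) →
    support c - dot c x ≡ (support c′ - dot c′ x) + t * excess x L
  support-layer {x} total c c′ t L c≡ ⊔≡ = begin
    support c - dot c x
      ≡⟨ cong₂ _-_ (cong₂ _+_ (sumℚ-cong n c≡) (edgeSum-cong G λ i j _ _ → ⊔≡ i j)) (dot-congˡ x c≡) ⟩
    (sumℚ n (λ v → c′ v + t * I v) + edgeSum G (λ i j → (c′ i ⊔ c′ j) + t * J i j)) - dot (λ v → c′ v + t * I v) x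
      ≡⟨ cong₂ _-_ (cong₂ _+_ (sumℚ-linear n c′ t I) (edgeSum-linear G (λ i j → c′ i ⊔ c′ j) t J)) (dot-linearˡ c′ I t x) ⟩
    ((sumℚ n c′ + t * sumℚ n I) + (E′ + t * edgeSum G J)) - (dot c′ x + t * dot I x)
      ≡⟨ cong₂ _-_ (cong₂ (λ a b → (sumℚ n c′ + t * a) + (E′ + t * b))
           (sumℚ-linear n (λ _ → 1ℚ) (- 1ℚ) (indicator L))
           (edgeSum-linear G (λ _ _ → 1ℚ) (- 1ℚ) (λ i j → 𝟙 (lookup L i ∧ lookup L j))))
           (cong (λ a → dot c′ x + t * a) (trans (dot-linearˡ (λ _ → 1ℚ) (indicator L) (- 1ℚ) x) (cong (_+ (- 1ℚ) * dot (indicator L) x) (dot-one total)))) ⟩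
    ((sumℚ n c′ + t * (Σ1 + - 1ℚ * ΣL)) + (E′ + t * (E1 + - 1ℚ * EL))) - (dot c′ x + t * ((Σ1 + E1) + - 1ℚ * dot (indicator L) x))
      ≡⟨ solve 9 (λ σ t a p e b q d l →
           ((σ :+ t :* (a :+ :- con 1ℚ :* p)) :+ (e :+ t :* (b :+ :- con 1ℚ :* q))) :- (d :+ t :* ((a :+ b) :+ :- con 1ℚ :* l))
           := ((σ :+ e) :- d) :+ t :* (l :- (p :+ q))) refl
           (sumℚ n c′) t Σ1 ΣL E′ E1 EL (dot c′ x) (dot (indicator L) x) ⟩
    (support c′ - dot c′ x) + t * excess x L ∎
    where
    open ≡-Reasoning
    I : Point n
    I v = 1ℚ + - 1ℚ * indicator L v
    J : Fin n → Fin n → ℚ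
    J i j = 1ℚ + - 1ℚ * 𝟙 (lookup L i ∧ lookup L j)
    Σ1 = sumℚ n (λ _ → 1ℚ)
    E1 = edgeSum G (λ _ _ → 1ℚ)
    ΣL = sumℚ n (indicator L)
    EL = edgeSum G (λ i j → 𝟙 (lookup L i ∧ lookup L j))
    E′ = edgeSum G (λ i j → c′ i ⊔ c′ j)

-- If both ends rise, so does their maximum; if only the first rises, the hypothesis keeps it below
-- the second.
bump-≤ : ∀ a b e s t → (s ≡ true → t ≡ false → a + e ≤ b) → a + e * 𝟙 s ≤ (a ⊔ b) + e * 𝟙 (s ∧ t)
bump-≤ a b e true  true  _ = ℚ.+-monoˡ-≤ (e * 1ℚ) (ℚ.p≤p⊔q a b)
bump-≤ a b e false t     _ = ℚ.+-monoˡ-≤ (e * 0ℚ) (ℚ.p≤p⊔q a b)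
bump-≤ a b e true  false a+e≤b = begin
  a + e * 1ℚ        ≡⟨ cong (a +_) (ℚ.*-identityʳ e) ⟩
  a + e             ≤⟨ a+e≤b refl refl ⟩
  b                 ≤⟨ ℚ.p≤q⊔p a b ⟩
  a ⊔ b             ≡⟨ solve 2 (λ x e → x := x :+ e :* con 0ℚ) refl (a ⊔ b) e ⟩
  (a ⊔ b) + e * 0ℚ  ∎
  where open ℚ.≤-Reasoning

0≤q-p : ∀ {p q} → p ≤ q → 0ℚ ≤ q - p
0≤q-p {p} {q} p≤q = ℚ.≤-trans (ℚ.≤-reflexive (≡-sym (ℚ.+-inverseʳ p))) (ℚ.+-monoˡ-≤ (- p) p≤q)

0≤q-p⇒p≤q : ∀ {p q} → 0ℚ ≤ q - p → p ≤ q
0≤q-p⇒p≤q {p} {q} 0≤ = begin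
  p             ≡⟨ ℚ.+-identityʳ p ⟨
  p + 0ℚ        ≤⟨ ℚ.+-monoʳ-≤ p 0≤ ⟩
  p + (q - p)   ≡⟨ solve 2 (λ p q → p :+ (q :- p) := q) refl p q ⟩
  q             ∎
  where open ℚ.≤-Reasoning

p-q≡0⇒p≡q : ∀ {p q} → p - q ≡ 0ℚ → p ≡ q
p-q≡0⇒p≡q {p} {q} eq = begin
  p            ≡⟨ solve 2 (λ p q → p := (p :- q) :+ q) refl p q ⟩
  (p - q) + q  ≡⟨ cong (_+ q) eq ⟩
  0ℚ + q       ≡⟨ ℚ.+-identityˡ q ⟩
  q            ∎
  where open ≡-Reasoning

p≡q⇒p-q≡0 : ∀ {p q} → p ≡ q → p - q ≡ 0ℚ
p≡q⇒p-q≡0 {p} refl = ℚ.+-inverseʳ p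

*-nonNeg : ∀ {p q} → 0ℚ ≤ p → 0ℚ ≤ q → 0ℚ ≤ p * q
*-nonNeg {p} {q} 0≤p 0≤q = ℚ.≤-trans (ℚ.≤-reflexive (≡-sym (ℚ.*-zeroʳ p)))
  (ℚ.*-monoˡ-≤-nonNeg p {{ℚ.nonNegative 0≤p}} 0≤q)

-- Lowering the top layer of a functional

module _ {n : ℕ} (c : Point n) (m m′ : ℚ) (m′≤m : m′ ≤ m)
  (c≤m : ∀ v → c v ≤ m) (next : ∀ v → c v < m → c v ≤ m′) where

  lowered : Point n
  lowered v = c v ⊓ m′

  lower? : ∀ v → Dec (c v < m)
  lower? v = c v ℚ.<? m

  layer-cases : ∀ v → (lookup ⟪ lower? ⟫ v ≡ true × lowered v ≡ c v × c v ≤ m′) ⊎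
    (lookup ⟪ lower? ⟫ v ≡ false × lowered v ≡ m′ × c v ≡ m)
  layer-cases v with c v ℚ.<? m
  ... | yes c<m = inj₁ ([]=⇒lookup (∈⟪⟫⁺ lower? c<m) , ℚ.p≤q⇒p⊓q≡p (next v c<m) , next v c<m)
  ... | no  c≮m = inj₂ (∉⇒lookup (c≮m ∘ ∈⟪⟫⁻ lower?) , ℚ.p≥q⇒p⊓q≡q (subst (m′ ≤_) (≡-sym c≡m) m′≤m) , c≡m)
    where c≡m = ℚ.≤-antisym (c≤m v) (ℚ.≮⇒≥ c≮m)

  restore-in : ∀ {a a′} b → b ≡ true → a′ ≡ a → a ≡ a′ + (m - m′) * (1ℚ + - 1ℚ * 𝟙 b)
  restore-in {a} _ refl refl = solve 2 (λ a t → a := a :+ t :* (con 1ℚ :+ :- con 1ℚ :* con 1ℚ)) refl a (m - m′)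

  restore-out : ∀ {a a′} b → b ≡ false → a′ ≡ m′ → a ≡ m → a ≡ a′ + (m - m′) * (1ℚ + - 1ℚ * 𝟙 b)
  restore-out _ refl refl refl =
    solve 2 (λ m m′ → m := m′ :+ (m :- m′) :* (con 1ℚ :+ :- con 1ℚ :* con 0ℚ)) refl m m′

  restore : ∀ v → c v ≡ lowered v + (m - m′) * (1ℚ + - 1ℚ * indicator ⟪ lower? ⟫ v)
  restore v with layer-cases v
  ... | inj₁ (Lv , c′≡c , _)  = restore-in _ Lv c′≡c
  ... | inj₂ (Lv , c′≡m′ , c≡m) = restore-out _ Lv c′≡m′ c≡m

  lowered≤ : ∀ v → lowered v ≤ m′
  lowered≤ v = ℚ.p⊓q≤q (c v) m′

  -- An end in the top layer attains the maximum before and after the lowering, so the maximum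
  -- changes unless both ends lie below that layer.
  restore-⊔ : ∀ i j → c i ⊔ c j ≡ (lowered i ⊔ lowered j) +
    (m - m′) * (1ℚ + - 1ℚ * 𝟙 (lookup ⟪ lower? ⟫ i ∧ lookup ⟪ lower? ⟫ j))
  restore-⊔ i j with layer-cases i | layer-cases j
  ... | inj₁ (Li , i′ , _) | inj₁ (Lj , j′ , _) = restore-in _ (cong₂ _∧_ Li Lj) (cong₂ _⊔_ i′ j′)
  ... | inj₂ (Li , i′ , i≡m) | _ = restore-out _ (cong (_∧ lookup ⟪ lower? ⟫ j) Li)
    (trans (ℚ.p≥q⇒p⊔q≡p (subst (lowered j ≤_) (≡-sym i′) (lowered≤ j))) i′)
    (trans (ℚ.p≥q⇒p⊔q≡p (subst (c j ≤_) (≡-sym i≡m) (c≤m j))) i≡m)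
  ... | inj₁ _ | inj₂ (Lj , j′ , j≡m) = restore-out _
    (trans (cong (lookup ⟪ lower? ⟫ i ∧_) Lj) (∧-zeroʳ _))
    (trans (ℚ.p≤q⇒p⊔q≡q (subst (lowered i ≤_) (≡-sym j′) (lowered≤ i))) j′)
    (trans (ℚ.p≤q⇒p⊔q≡q (subst (c i ≤_) (≡-sym j≡m) (c≤m i))) j≡m)

-- Maximisers of a functional on the polytope

module _ {n : ℕ} (G : Graph n) where

  -- Abel summation: support c - dot c x is a nonnegative combination of the
  -- excesses of x on sublevel sets of c.
  support-excess : (K : ℚ → Set) → K 0ℚ → (∀ {a b} → K a → K b → K (a + b)) →
    (∀ {t a} → 0ℚ ≤ t → K a → K (t * a)) →
    ∀ {x} → Tight G x ⊤ → ∀ c →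
    (∀ S → ClosedUnder (λ u v → c u ≤ c v) S → K (excess G x S)) → K (support G c - dot c x)
  support-excess K K0 K+ K* {x} total = layer-induction
    (λ c → (∀ S → ClosedUnder (λ u v → c u ≤ c v) S → K (excess G x S)) → K (support G c - dot c x))
    (λ c m c≡m _ → subst K (≡-sym (support-constant G total c m c≡m)) K0)
    λ c m m′ m′≤m c≤m next ih closed⇒K → subst K
      (≡-sym (support-layer G total c (lowered c m m′ m′≤m c≤m next) (m - m′) ⟪ lower? c m m′ m′≤m c≤m next ⟫
        (restore c m m′ m′≤m c≤m next) (restore-⊔ c m m′ m′≤m c≤m next)))
      -- Truncation is monotone, so a set closed for the lowered functional is closed for `c`; the
      -- set removed at this layer is itself a sublevel set of `c`.
      (K+ (ih λ S closed → closed⇒K S λ u v u≤v → closed u v (ℚ.⊓-monoˡ-≤ m′ u≤v))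
        (K* (0≤q-p m′≤m) (closed⇒K _ λ u v u≤v v∈ →
          ∈⟪⟫⁺ (lower? c m m′ m′≤m c≤m next)
            (ℚ.≤-<-trans u≤v (∈⟪⟫⁻ (lower? c m m′ m′≤m c≤m next) v∈)))))

  -- Abel summation with `K` as nonnegativity: a point of P_G has no negative excess.
  dot≤support : ∀ {x} → PG G x → ∀ c → dot c x ≤ support G c
  dot≤support {x} x∈P c = 0≤q-p⇒p≤q (support-excess (0ℚ ≤_) ℚ.≤-refl
    (λ 0≤a 0≤b → ℚ.≤-trans (ℚ.≤-reflexive (≡-sym (ℚ.+-identityʳ 0ℚ))) (ℚ.+-mono-≤ 0≤a 0≤b))
    *-nonNeg (PG-total G x∈P) c λ S _ → 0≤q-p (PG-bound G x∈P S))

  -- Read in both directions of an edge, this makes `c` constant across undirected edges and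
  -- strictly increasing along directed ones.
  Compatible : Orientation n → Point n → Set
  Compatible O c = ∀ u v → Adj G u v → (Below G O u v → c u ≤ c v) × (c u ≤ c v → Below G O u v)

  compatible⇒≤ : ∀ {O c} → Compatible O c → ∀ u v → Below G O u v → c u ≤ c v
  compatible⇒≤ compat u v below = proj₁ (compat u v (proj₁ below)) below

  -- The center gives each edge to the end with the larger value and halves it on ties, so every
  -- edge contributes its maximum. Hence the bound `support` is attained on P_G.
  dot-center≡support : ∀ {O c} → Compatible O c → dot c (center G O) ≡ support G c
  dot-center≡support {O} {c} compat = trans (dot-center G O c)
    (cong (sumℚ n c +_) (edgeSum-cong G λ i j i<j ij → split-⊔ (O i j) (c i) (c j)
      (λ m≢bwd → compatible⇒≤ compat i j (ij , m≢bwd ∘ trans (≡-sym (mark-< O i<j))))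
      (λ m≢bwd → compatible⇒≤ compat j i (Adj-sym G ij , m≢bwd ∘ trans (≡-sym (mark-> O i<j))))))
    where
    split-⊔ : ∀ m a b → (m ≢ bwd → a ≤ b) → (flip m ≢ bwd → b ≤ a) → split m a b ≡ a ⊔ b
    split-⊔ und a b a≤b b≤a with refl ← ℚ.≤-antisym (a≤b λ ()) (b≤a λ ()) =
      trans (split-diagonal und a) (≡-sym (ℚ.⊔-idem a))
    split-⊔ fwd a b a≤b _ = ≡-sym (ℚ.p≤q⇒p⊔q≡q (a≤b λ ()))
    split-⊔ bwd a b _ b≤a = ≡-sym (ℚ.p≥q⇒p⊔q≡p (b≤a λ ()))

  -- Abel summation with `K` as vanishing: the sublevel sets of a compatible functional are closed
  -- for O, and there the excess is 0.
  face⇒support : ∀ {O c} → Compatible O c → ∀ {x} → face G O x → dot c x ≡ support G c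
  face⇒support {O} {c} compat {x} (x∈P , tight) = ≡-sym (p-q≡0⇒p≡q (support-excess (_≡ 0ℚ) refl
    (λ { refl refl → refl }) (λ { {t} _ refl → ℚ.*-zeroʳ t }) (PG-total G x∈P) c
    λ S closed → p≡q⇒p-q≡0 (tight S λ u v below → closed u v (compatible⇒≤ compat u v below))))

  -- If x maximises c and S is closed, raising c slightly on S raises the
  -- support function at the rate rank S, so x cannot exceed rank S on S.
  support⇒face : ∀ {O c} → Compatible O c → ∀ {x} → PG G x → dot c x ≡ support G c → face G O x
  support⇒face {O} {c} compat {x} x∈P max = x∈P , λ S closed → ℚ.≤-antisym (tight S closed) (PG-bound G x∈P S)
    where
    e : ℚ
    -- At most every positive difference of values of `c`, so a rise by `e` overtakes no strictly
    -- larger value.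
    e = proj₁ (gap₂ n n λ u v → c v - c u)
    0<e : 0ℚ < e
    0<e = proj₁ (proj₂ (gap₂ n n λ u v → c v - c u))
    e-gap : ∀ u v → c u < c v → c u + e ≤ c v
    e-gap u v u<v = begin
      c u + e            ≤⟨ ℚ.+-monoʳ-≤ (c u) (proj₂ (proj₂ (gap₂ n n λ u v → c v - c u)) u v
                              (subst (_< c v - c u) (ℚ.+-inverseʳ (c u)) (ℚ.+-monoˡ-< (- c u) u<v))) ⟩
      c u + (c v - c u)  ≡⟨ solve 2 (λ p q → p :+ (q :- p) := q) refl (c u) (c v) ⟩
      c v                ∎
      where open ℚ.≤-Reasoning

    module _ (S : Subset n) (closed : Closed G O S) where
      -- Otherwise compatibility would put `v` below `u`, and closedness would pull it into `S`.
      leaves : ∀ u v → Adj G u v → lookup S u ≡ true → lookup S v ≡ false → c u + e ≤ c v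
      leaves u v uv Su Sv = e-gap u v (ℚ.≰⇒> λ v≤u → true≢false
        (trans (≡-sym ([]=⇒lookup (closed v u (proj₂ (compat v u (Adj-sym G uv)) v≤u) (lookup⇒[]= u S Su)))) Sv))
        where
        true≢false : true ≢ false
        true≢false ()

      raised-⊔ : ∀ i j → Adj G i j → (c i + e * indicator S i) ⊔ (c j + e * indicator S j) ≤
        (c i ⊔ c j) + e * 𝟙 (lookup S i ∧ lookup S j)
      raised-⊔ i j ij = ℚ.⊔-lub (bump-≤ (c i) (c j) e (lookup S i) (lookup S j) (leaves i j ij))
        (ℚ.≤-trans (bump-≤ (c j) (c i) e (lookup S j) (lookup S i) (leaves j i (Adj-sym G ij)))
          (ℚ.≤-reflexive (cong₂ (λ a b → a + e * 𝟙 b) (ℚ.⊔-comm (c j) (c i)) (∧-comm (lookup S j) (lookup S i)))))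

      raised : dot c x + e * dot (indicator S) x ≤ dot c x + e * rank G S
      raised = begin
        dot c x + e * dot (indicator S) x
          ≡⟨ dot-linearˡ c (indicator S) e x ⟨
        dot (λ v → c v + e * indicator S v) x
          ≤⟨ dot≤support x∈P (λ v → c v + e * indicator S v) ⟩
        support G (λ v → c v + e * indicator S v)
          ≤⟨ ℚ.+-monoʳ-≤ (sumℚ n λ v → c v + e * indicator S v) (edgeSum-mono G λ i j _ ij → raised-⊔ i j ij) ⟩
        sumℚ n (λ v → c v + e * indicator S v) + edgeSum G (λ i j → (c i ⊔ c j) + e * 𝟙 (lookup S i ∧ lookup S j))
          ≡⟨ cong₂ _+_ (sumℚ-linear n c e (indicator S))
               (edgeSum-linear G (λ i j → c i ⊔ c j) e (λ i j → 𝟙 (lookup S i ∧ lookup S j))) ⟩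
        (sumℚ n c + e * sumℚ n (indicator S)) + (E⊔ + e * E∧)
          ≡⟨ solve 5 (λ a e b p q → (a :+ e :* b) :+ (p :+ e :* q) := (a :+ p) :+ e :* (b :+ q)) refl
               (sumℚ n c) e (sumℚ n (indicator S)) E⊔ E∧ ⟩
        support G c + e * rank G S
          ≡⟨ cong (_+ e * rank G S) max ⟨
        dot c x + e * rank G S ∎
        where
        open ℚ.≤-Reasoning
        E⊔ = edgeSum G (λ i j → c i ⊔ c j)
        E∧ = edgeSum G (λ i j → 𝟙 (lookup S i ∧ lookup S j))

      tight : dot (indicator S) x ≤ rank G S
      tight = ℚ.*-cancelˡ-≤-pos {dot (indicator S) x} {rank G S} e {{ℚ.positive 0<e}}
        (cancel (dot c x) (e * dot (indicator S) x) (e * rank G S) raised)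
        where
        cancel : ∀ a p q → a + p ≤ a + q → p ≤ q
        cancel a p q le = begin
          p              ≡⟨ solve 2 (λ a p → p := (:- a) :+ (a :+ p)) refl a p ⟩
          - a + (a + p)  ≤⟨ ℚ.+-monoʳ-≤ (- a) le ⟩
          - a + (a + q)  ≡⟨ solve 2 (λ a q → (:- a) :+ (a :+ q) := q) refl a q ⟩
          q              ∎
          where open ℚ.≤-Reasoning

  compatible⇒isFace : ∀ {O c} → Compatible O c → IsFace (PG G) (face G O)
  compatible⇒isFace {O} {c} compat = c , support G c , (λ x x∈P → dot≤support x∈P c) ,
    λ x → mk⇔ (λ x∈F → proj₁ x∈F , face⇒support compat x∈F) (λ { (x∈P , max) → support⇒face compat x∈P max })

-- Partial acyclic orientations

mark-Undir : ∀ {n} {O : Orientation n} {u v} → Undir O u v → mark O u v ≡ und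
mark-Undir {u = u} {v} (u<v⇒ , v<u⇒) with Fin.<-cmp u v
... | tri< u<v _ _ = u<v⇒ u<v
... | tri≈ _ _ _   = refl
... | tri> _ _ v<u = cong flip (v<u⇒ v<u)

mark-Arrow : ∀ {n} {O : Orientation n} {u v} → u ≢ v → Arrow O u v → mark O u v ≡ fwd
mark-Arrow {u = u} {v} u≢v (u<v⇒ , v<u⇒) with Fin.<-cmp u v
... | tri< u<v _ _ = u<v⇒ u<v
... | tri≈ _ u≡v _ = ⊥-elim (u≢v u≡v)
... | tri> _ _ v<u = cong flip (v<u⇒ v<u)

mark-flip : ∀ {n} (O : Orientation n) {u v} → u ≢ v → mark O v u ≡ flip (mark O u v)
mark-flip O {u} {v} u≢v = by (Fin.<-cmp u v)
  where
  flip-flip : ∀ m → m ≡ flip (flip m)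
  flip-flip und = refl
  flip-flip fwd = refl
  flip-flip bwd = refl
  by : Tri (u Fin.< v) (u ≡ v) (v Fin.< u) → mark O v u ≡ flip (mark O u v)
  by (tri< u<v _ _) = trans (mark-> O u<v) (cong flip (≡-sym (mark-< O u<v)))
  by (tri≈ _ u≡v _) = ⊥-elim (u≢v u≡v)
  by (tri> _ _ v<u) = trans (mark-< O v<u) (trans (flip-flip (O v u)) (cong flip (≡-sym (mark-> O v<u))))

-- The three marks differ in which of their two readings avoid `bwd`, which is all that `Below`
-- records.
mark-unique : ∀ {m m′} → (m ≢ bwd → m′ ≢ bwd) → (m′ ≢ bwd → m ≢ bwd) →
  (flip m ≢ bwd → flip m′ ≢ bwd) → (flip m′ ≢ bwd → flip m ≢ bwd) → m ≡ m′
mark-unique {und} {und} _ _ _ _ = refl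
mark-unique {fwd} {fwd} _ _ _ _ = refl
mark-unique {bwd} {bwd} _ _ _ _ = refl
mark-unique {und} {fwd} _ _ a _ = ⊥-elim (a (λ ()) refl)
mark-unique {und} {bwd} a _ _ _ = ⊥-elim (a (λ ()) refl)
mark-unique {fwd} {und} _ _ _ a = ⊥-elim (a (λ ()) refl)
mark-unique {fwd} {bwd} a _ _ _ = ⊥-elim (a (λ ()) refl)
mark-unique {bwd} {und} _ a _ _ = ⊥-elim (a (λ ()) refl)
mark-unique {bwd} {fwd} _ a _ _ = ⊥-elim (a (λ ()) refl)

module _ {n : ℕ} {G : Graph n} (O : PAO G) where

  private
    _⊏_ : Fin n → Fin n → Set
    _⊏_ = DirEdge G (β O) (ω O)

  Adj-cases : ∀ {u v} → Adj G u v →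
    (β O u ≡ β O v × mark (ori O) u v ≡ und) ⊎
    (β O u ⊏ β O v × mark (ori O) u v ≡ fwd) ⊎
    (β O v ⊏ β O u × mark (ori O) u v ≡ bwd)
  Adj-cases {u} {v} uv with β O u Fin.≟ β O v
  ... | yes eq = inj₁ (eq , mark-Undir (inside O u v uv eq))
  ... | no neq with proj₁ (acyc O) (β O u) (β O v) (neq , u , v , refl , refl , uv)
  ...   | inj₁ ωuv = inj₂ (inj₁ (((neq , u , v , refl , refl , uv) , ωuv) ,
            mark-Arrow (Adj⇒≢ G uv) (between O u v uv neq ωuv)))
  ...   | inj₂ ωvu = inj₂ (inj₂ (((neq ∘ ≡-sym , v , u , refl , refl , vu) , ωvu) ,
            trans (mark-flip (ori O) (Adj⇒≢ G vu)) (cong flip (mark-Arrow (Adj⇒≢ G vu) (between O v u vu (neq ∘ ≡-sym) ωvu)))))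
    where vu = Adj-sym G uv

  below⇒⊏ : ∀ {u v} → Below G (ori O) u v → β O u ≡ β O v ⊎ β O u ⊏ β O v
  below⇒⊏ (uv , m≢bwd) with Adj-cases uv
  ... | inj₁ (eq , _)          = inj₁ eq
  ... | inj₂ (inj₁ (u⊏v , _))  = inj₂ u⊏v
  ... | inj₂ (inj₂ (_ , m≡bwd)) = ⊥-elim (m≢bwd m≡bwd)

  ⊏-asym : ∀ {a b} → a ⊏ b → ¬ b ⊏ a
  ⊏-asym a⊏b b⊏a = proj₂ (proj₂ (acyc O)) _ (a⊏b ∷ [ b⊏a ])

  block⇒below : ∀ {u v} → Adj G u v → β O u ≡ β O v → Below G (ori O) u v
  block⇒below uv eq with Adj-cases uv
  ... | inj₁ (_ , m≡und)                = uv , λ m≡bwd → und≢bwd (trans (≡-sym m≡und) m≡bwd)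
    where
    und≢bwd : und ≢ bwd
    und≢bwd ()
  ... | inj₂ (inj₁ (((neq , _) , _) , _)) = ⊥-elim (neq eq)
  ... | inj₂ (inj₂ (((neq , _) , _) , _)) = ⊥-elim (neq (≡-sym eq))

  ⊏⇒below : ∀ {u v} → Adj G u v → β O u ⊏ β O v → Below G (ori O) u v
  ⊏⇒below uv u⊏v with Adj-cases uv
  ... | inj₁ (eq , _)           = ⊥-elim (proj₁ (proj₁ u⊏v) eq)
  ... | inj₂ (inj₂ (v⊏u , _))   = ⊥-elim (⊏-asym u⊏v v⊏u)
  ... | inj₂ (inj₁ (_ , m≡fwd)) = uv , λ m≡bwd → fwd≢bwd (trans (≡-sym m≡fwd) m≡bwd)
    where
    fwd≢bwd : fwd ≢ bwd
    fwd≢bwd ()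

  ¬below⇒⊏ : ∀ {u v} → Adj G u v → ¬ Below G (ori O) u v → β O v ⊏ β O u
  ¬below⇒⊏ uv ¬below with Adj-cases uv
  ... | inj₁ (eq , _)          = ⊥-elim (¬below (block⇒below uv eq))
  ... | inj₂ (inj₁ (u⊏v , _))  = ⊥-elim (¬below (⊏⇒below uv u⊏v))
  ... | inj₂ (inj₂ (v⊏u , _))  = v⊏u

  below*⇒⊏ : ∀ {u v} → Star (Below G (ori O)) u v → β O u ≡ β O v ⊎ TransClosure _⊏_ (β O u) (β O v)
  below*⇒⊏ ε = inj₁ refl
  below*⇒⊏ {v = v} (b ◅ bs) with below⇒⊏ b | below*⇒⊏ bs
  ... | inj₁ eq | inj₁ eq′  = inj₁ (trans eq eq′)
  ... | inj₁ eq | inj₂ ⊏*   = inj₂ (subst (λ a → TransClosure _⊏_ a (β O v)) (≡-sym eq) ⊏*)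
  ... | inj₂ ⊏₁ | inj₁ eq′  = inj₂ (subst (TransClosure _⊏_ _) eq′ [ ⊏₁ ])
  ... | inj₂ ⊏₁ | inj₂ ⊏*   = inj₂ (⊏₁ ∷ ⊏*)

  -- Paths both ways between different blocks would project to a directed cycle of blocks.
  below*-antisym : ∀ {u v} → Star (Below G (ori O)) u v → Star (Below G (ori O)) v u → β O u ≡ β O v
  below*-antisym uv vu with below*⇒⊏ uv | below*⇒⊏ vu
  ... | inj₁ eq | _       = eq
  ... | _       | inj₁ eq = ≡-sym eq
  ... | inj₂ ⊏* | inj₂ ⊐* = ⊥-elim (proj₂ (proj₂ (acyc O)) _ (⊏* ++ ⊐*))

  -- Connectedness of the blocks enters here: a path inside a block consists of undirected edges.
  block⇒below* : ∀ {u v} → β O u ≡ β O v → Star (Below G (ori O)) u v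
  block⇒below* eq = Star.map (λ { (uv , eq) → block⇒below uv eq }) (conn O _ _ eq)

  closed-block : ∀ {S u v} → Closed G (ori O) S → β O u ≡ β O v → v ∈ S → u ∈ S
  closed-block closed eq = closed-Star closed (block⇒below* eq)

  InJ⇒closed : ∀ {S} → InJ O S → Closed G (ori O) S
  InJ⇒closed (I , ideal , S⇔I) u v below v∈S with below⇒⊏ below
  ... | inj₁ eq  = Equivalence.from (S⇔I u) (subst (_∈ I) (≡-sym eq) (Equivalence.to (S⇔I v) v∈S))
  ... | inj₂ u⊏v = Equivalence.from (S⇔I u) (ideal _ _ [ u⊏v ] (Equivalence.to (S⇔I v) v∈S))

  -- A closed set is a union of blocks, so the labels of the blocks that it meets determine it; they
  -- form an ideal because each relation between blocks comes from an edge.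
  closed⇒InJ : ∀ {S} → Closed G (ori O) S → InJ O S
  closed⇒InJ {S} closed = ⟪ meets? ⟫ , ideal , λ v → mk⇔
    (λ v∈S → ∈⟪⟫⁺ meets? (v , refl , v∈S))
    (λ βv∈ → let (w , eq , w∈S) = ∈⟪⟫⁻ meets? βv∈ in closed-block closed (≡-sym eq) w∈S)
    where
    meets? : ∀ a → Dec (∃ λ v → β O v ≡ a × v ∈ S)
    meets? a = any? λ v → (β O v Fin.≟ a) ×-dec (v ∈? S)
    step : ∀ {a b} → a ⊏ b → b ∈ ⟪ meets? ⟫ → a ∈ ⟪ meets? ⟫
    step a⊏b@((_ , u , v , refl , refl , uv) , _) b∈ with ∈⟪⟫⁻ meets? b∈
    ... | w , eq , w∈S = ∈⟪⟫⁺ meets? (u , refl ,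
      closed u v (⊏⇒below uv a⊏b) (closed-block closed (≡-sym eq) w∈S))
    ideal : IsIdeal O ⟪ meets? ⟫
    ideal a b [ a⊏b ] b∈      = step a⊏b b∈
    ideal a b (a⊏c ∷ c⊏*b) b∈ = step a⊏c (ideal _ b c⊏*b b∈)

  down : Fin n → Subset n
  down v = proj₁ (downset (below? G (ori O)) v)

  down-closed : ∀ v → Closed G (ori O) (down v)
  down-closed v = proj₁ (proj₂ (downset (below? G (ori O)) v))

  self∈down : ∀ v → v ∈ down v
  self∈down v = proj₁ (proj₂ (proj₂ (downset (below? G (ori O)) v)))

  down⇒below* : ∀ {u} v → u ∈ down v → Star (Below G (ori O)) u v
  down⇒below* v = proj₂ (proj₂ (proj₂ (downset (below? G (ori O)) v))) _

  -- Such an edge is directed from `v` to `u`, and a path back from `u` to `v` would contradict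
  -- acyclicity.
  ¬below⇒∉down : ∀ {u v} → Adj G u v → ¬ Below G (ori O) u v → u ∉ down v
  ¬below⇒∉down {u} {v} uv ¬below u∈ = proj₁ (proj₁ v⊏u)
    (below*-antisym (⊏⇒below (Adj-sym G uv) v⊏u ◅ ε) (down⇒below* v u∈))
    where v⊏u = ¬below⇒⊏ uv ¬below

  height : Point n
  height v = ℕ→ℚ ∣ down v ∣

  -- Generated ideals grow along `Below`, and strictly along a directed edge, because the ideal of
  -- the tail misses the head.
  height-compatible : Compatible G (ori O) height
  height-compatible u v uv = below⇒≤ , ≤⇒below
    where
    down-mono : ∀ {u v} → Below G (ori O) u v → down u ⊆ down v
    down-mono {u} {v} below w∈ = closed-Star (down-closed v) (down⇒below* u w∈)
      (down-closed v u v below (self∈down v))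
    below⇒≤ : Below G (ori O) u v → height u ≤ height v
    below⇒≤ below = ℕ→ℚ-mono-≤ (p⊆q⇒∣p∣≤∣q∣ (down-mono below))
    ≤⇒below : height u ≤ height v → Below G (ori O) u v
    ≤⇒below u≤v with below? G (ori O) u v
    ... | yes below = below
    ... | no ¬below = ⊥-elim (ℕ.<⇒≱ (p⊂q⇒∣p∣<∣q∣
      (down-mono (⊏⇒below (Adj-sym G uv) (¬below⇒⊏ uv ¬below)) , u , self∈down u , ¬below⇒∉down uv ¬below))
      (ℕ→ℚ-cancel-≤ u≤v))

-- Inclusion of faces and of closed sets

module _ {n : ℕ} {G : Graph n} where

  below-respects : ∀ {O O′ : Orientation n} → O ≈ₒ⟨ G ⟩ O′ → ∀ {u v} → Below G O u v → Below G O′ u v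
  below-respects {O} {O′} O≈O′ {u} {v} (uv , m≢bwd) = uv , m≢bwd ∘ trans (by (Fin.<-cmp u v))
    where
    by : Tri (u Fin.< v) (u ≡ v) (v Fin.< u) → mark O u v ≡ mark O′ u v
    by (tri< u<v _ _) = trans (mark-< O u<v) (trans (O≈O′ u v u<v uv) (≡-sym (mark-< O′ u<v)))
    by (tri≈ _ u≡v _) = ⊥-elim (Adj⇒≢ G uv u≡v)
    by (tri> _ _ v<u) = trans (mark-> O v<u) (trans (cong flip (O≈O′ v u v<u (Adj-sym G uv))) (≡-sym (mark-> O′ v<u)))

  face-respects : ∀ {O O′ : Orientation n} → O ≈ₒ⟨ G ⟩ O′ → face G O ⊆ₚ face G O′
  face-respects O≈O′ x (x∈P , tight) = x∈P , λ S closed → tight S λ u v below →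
    closed u v (below-respects O≈O′ below)

  -- It suffices to test the inclusion on the center of `O`, whose tight sets are exactly the closed
  -- sets of `O`.
  face-⊆⇒closed : ∀ {O O′ : Orientation n} → face G O ⊆ₚ face G O′ → ∀ S → Closed G O′ S → Closed G O S
  face-⊆⇒closed {O} sub S closed = tight⇒closed G O S (proj₂ (sub (center G O) (center∈face G O)) S closed)

  -- The test set is the ideal that `v` generates under `O′`: it would miss `u` if the edge were not
  -- `Below` for `O′`.
  closed-⊆⇒below : ∀ (O O′ : PAO G) → (∀ S → Closed G (ori O′) S → Closed G (ori O) S) →
    ∀ {u v} → Below G (ori O) u v → Below G (ori O′) u v
  closed-⊆⇒below O O′ sub {u} {v} below with below? G (ori O′) u v
  ... | yes below′ = below′
  ... | no ¬below′ = ⊥-elim (¬below⇒∉down O′ (proj₁ below) ¬below′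
    (sub (down O′ v) (down-closed O′ v) u v below (self∈down O′ v)))

  -- Equal faces have the same closed sets, hence the same `Below` relation, and its two directions
  -- on an edge determine the mark.
  face-injective : ∀ (O O′ : PAO G) → face G (ori O) ≐ face G (ori O′) → ori O ≈ₒ⟨ G ⟩ ori O′
  face-injective O O′ (sub , sup) i j i<j ij = mark-unique
    (λ m → proj₂ (to (ij , m ∘ trans (≡-sym (mark-< _ i<j)))) ∘ trans (mark-< _ i<j))
    (λ m → proj₂ (from (ij , m ∘ trans (≡-sym (mark-< _ i<j)))) ∘ trans (mark-< _ i<j))
    (λ m → proj₂ (to (Adj-sym G ij , m ∘ trans (≡-sym (mark-> _ i<j)))) ∘ trans (mark-> _ i<j))
    (λ m → proj₂ (from (Adj-sym G ij , m ∘ trans (≡-sym (mark-> _ i<j)))) ∘ trans (mark-> _ i<j))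
    where
    to : ∀ {u v} → Below G (ori O) u v → Below G (ori O′) u v
    to = closed-⊆⇒below O O′ (face-⊆⇒closed sub)
    from : ∀ {u v} → Below G (ori O′) u v → Below G (ori O) u v
    from = closed-⊆⇒below O′ O (face-⊆⇒closed sup)

  face-⊆⇔⪯z : ∀ (O O′ : PAO G) → (face G (ori O) ⊆ₚ face G (ori O′)) ⇔ (O ⪯z O′)
  face-⊆⇔⪯z O O′ = mk⇔
    (λ sub S S∈J′ → closed⇒InJ O (face-⊆⇒closed sub S (InJ⇒closed O′ S∈J′)))
    (λ O⪯O′ x (x∈P , tight) → x∈P , λ S closed′ → tight S (InJ⇒closed O (O⪯O′ S (closed⇒InJ O′ closed′))))

-- The orientation of a linear functional

compareMark : ℚ → ℚ → Mark
compareMark a b with ℚ.<-cmp a b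
... | tri< _ _ _ = fwd
... | tri≈ _ _ _ = und
... | tri> _ _ _ = bwd

compareMark-≡ : ∀ {a b} → a ≡ b → compareMark a b ≡ und
compareMark-≡ {a} {b} a≡b with ℚ.<-cmp a b
... | tri< _ a≢b _ = ⊥-elim (a≢b a≡b)
... | tri≈ _ _ _   = refl
... | tri> _ a≢b _ = ⊥-elim (a≢b a≡b)

compareMark-< : ∀ {a b} → a < b → compareMark a b ≡ fwd
compareMark-< {a} {b} a<b with ℚ.<-cmp a b
... | tri< _ _ _   = refl
... | tri≈ a≮b _ _ = ⊥-elim (a≮b a<b)
... | tri> a≮b _ _ = ⊥-elim (a≮b a<b)

compareMark-> : ∀ {a b} → b < a → compareMark a b ≡ bwd
compareMark-> {a} {b} b<a with ℚ.<-cmp a b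
... | tri< _ _ b≮a = ⊥-elim (b≮a b<a)
... | tri≈ _ _ b≮a = ⊥-elim (b≮a b<a)
... | tri> _ _ _   = refl

compareMark-flip : ∀ a b → flip (compareMark a b) ≡ compareMark b a
compareMark-flip a b with ℚ.<-cmp a b
... | tri< a<b _ _ = ≡-sym (compareMark-> a<b)
... | tri≈ _ a≡b _ = ≡-sym (compareMark-≡ (≡-sym a≡b))
... | tri> _ _ b<a = ≡-sym (compareMark-< b<a)

≤⇒compareMark : ∀ {a b} → a ≤ b → compareMark a b ≢ bwd
≤⇒compareMark {a} {b} a≤b eq with ℚ.<-cmp a b
... | tri> _ _ b<a = ℚ.<-irrefl refl (ℚ.<-≤-trans b<a a≤b)

compareMark⇒≤ : ∀ {a b} → compareMark a b ≢ bwd → a ≤ b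
compareMark⇒≤ {a} {b} ≢bwd with ℚ.<-cmp a b
... | tri< a<b _ _ = ℚ.<⇒≤ a<b
... | tri≈ _ a≡b _ = ℚ.≤-reflexive a≡b
... | tri> _ _ _   = ⊥-elim (≢bwd refl)

-- On nonempty sets the choice depends on the set alone, which makes it a canonical label; the
-- default only serves the empty set.
pick : ∀ {n} → Fin n → Subset n → Fin n
pick default S with nonempty? S
... | yes (v , _) = v
... | no _        = default

pick-∈ : ∀ {n} default {S : Subset n} → ∃ (_∈ S) → pick default S ∈ S
pick-∈ default {S} ne with nonempty? S
... | yes (_ , v∈S) = v∈S
... | no ¬ne        = ⊥-elim (¬ne ne)

pick-irrelevant : ∀ {n} d d′ {S : Subset n} → ∃ (_∈ S) → pick d S ≡ pick d′ S
pick-irrelevant d d′ {S} ne with nonempty? S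
... | yes _  = refl
... | no ¬ne = ⊥-elim (¬ne ne)

module _ {n : ℕ} (G : Graph n) (c : Point n) where

  Level : Fin n → Fin n → Set
  Level u v = Adj G u v × c u ≡ c v

  level? : ∀ u v → Dec (Level u v)
  level? u v = (adj G u v Bool.≟ true) ×-dec (c u ℚ.≟ c v)

  Level*-sym : ∀ {u v} → Star Level u v → Star Level v u
  Level*-sym = Star.reverse λ { (uv , eq) → Adj-sym G uv , ≡-sym eq }

  Level*⇒≡ : ∀ {u v} → Star Level u v → c u ≡ c v
  Level*⇒≡ ε              = refl
  Level*⇒≡ ((_ , eq) ◅ l) = trans eq (Level*⇒≡ l)

  component : Fin n → Subset n
  component v = proj₁ (downset level? v)

  component⁻ : ∀ {u v} → u ∈ component v → Star Level u v
  component⁻ {u} {v} = proj₂ (proj₂ (proj₂ (downset level? v))) u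

  component⁺ : ∀ {u v} → Star Level u v → u ∈ component v
  component⁺ {u} {v} l with downset level? v
  ... | S , closed , v∈S , _ = closed-Star closed l v∈S

  component-≡ : ∀ {u v} → Star Level u v → component u ≡ component v
  component-≡ l = ⊆-antisym
    (λ w∈ → component⁺ (component⁻ w∈ ◅◅ l))
    (λ w∈ → component⁺ (component⁻ w∈ ◅◅ Level*-sym l))

  -- The label of a component is one of its own vertices, so `c` can be evaluated on labels;
  -- `levelω` orients the block graph this way.
  block : Fin n → Fin n
  block v = pick v (component v)

  block-Level* : ∀ v → Star Level (block v) v
  block-Level* v = component⁻ (pick-∈ v (v , component⁺ ε))

  block-≡ : ∀ {u v} → Star Level u v → block u ≡ block v
  block-≡ {u} {v} l = trans (cong (pick u) (component-≡ l)) (pick-irrelevant u v (v , component⁺ ε))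

  c-block : ∀ v → c (block v) ≡ c v
  c-block v = Level*⇒≡ (block-Level* v)

  block⇒Level* : ∀ {u v} → block u ≡ block v → Star Level u v
  block⇒Level* {u} {v} eq = Level*-sym (block-Level* u) ◅◅ subst (λ b → Star Level b v) (≡-sym eq) (block-Level* v)

  levelOri : Orientation n
  levelOri i j = compareMark (c i) (c j)

  levelω : Fin n → Fin n → Bool
  levelω a b = does (c a ℚ.<? c b)

  levelω⁻ : ∀ {a b} → levelω a b ≡ true → c a < c b
  levelω⁻ {a} {b} = does⇒ (c a ℚ.<? c b)

  levelω-dir : ∀ {a b} → DirEdge G block levelω a b → c a < c b
  levelω-dir (_ , ω≡true) = levelω⁻ ω≡true

  levelω-trans : ∀ {a b} → TransClosure (DirEdge G block levelω) a b → c a < c b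
  levelω-trans [ d ]    = levelω-dir d
  levelω-trans (d ∷ ds) = ℚ.<-trans (levelω-dir d) (levelω-trans ds)

  levelPAO : PAO G
  levelPAO = record
    { ori     = levelOri
    ; β       = block
    ; ω       = levelω
    ; conn    = λ u v eq → Star.map (λ { l@(uv , _) → uv , block-≡ (l ◅ ε) }) (block⇒Level* eq)
    ; acyc    = total , (λ a b _ a<b → dec-false (c b ℚ.<? c a) (ℚ.<-asym (levelω⁻ a<b))) ,
                λ a cycle → ℚ.<-irrefl refl (levelω-trans cycle)
    ; inside  = λ u v uv eq → let cu≡cv = Level*⇒≡ (block⇒Level* eq) in
                (λ _ → compareMark-≡ cu≡cv) , (λ _ → compareMark-≡ (≡-sym cu≡cv))
    ; between = λ u v uv _ ω≡true → let cu<cv = subst₂ _<_ (c-block u) (c-block v) (levelω⁻ ω≡true) in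
                (λ _ → compareMark-< cu<cv) , (λ _ → compareMark-> cu<cv)
    }
    where
    total : ∀ a b → BlockAdj G block a b → (levelω a b ≡ true) ⊎ (levelω b a ≡ true)
    total _ _ (a≢b , u , v , refl , refl , uv) with ℚ.<-cmp (c (block u)) (c (block v))
    ... | tri< a<b _ _ = inj₁ (dec-true (c (block u) ℚ.<? c (block v)) a<b)
    -- Adjacent blocks of equal value would form a single component.
    ... | tri≈ _ a≡b _ = ⊥-elim (a≢b (block-≡ ((uv , trans (≡-sym (c-block u)) (trans a≡b (c-block v))) ◅ ε)))
    ... | tri> _ _ b<a = inj₂ (dec-true (c (block v) ℚ.<? c (block u)) b<a)

  mark-levelOri : ∀ {u v} → u ≢ v → mark levelOri u v ≡ compareMark (c u) (c v)
  mark-levelOri {u} {v} u≢v with Fin.<-cmp u v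
  ... | tri< _ _ _   = refl
  ... | tri≈ _ u≡v _ = ⊥-elim (u≢v u≡v)
  ... | tri> _ _ _   = compareMark-flip (c v) (c u)

  level-compatible : Compatible G levelOri c
  level-compatible u v uv =
    (λ { (_ , m≢bwd) → compareMark⇒≤ (m≢bwd ∘ trans (mark-levelOri (Adj⇒≢ G uv))) }) ,
    (λ u≤v → uv , ≤⇒compareMark u≤v ∘ trans (≡-sym (mark-levelOri (Adj⇒≢ G uv))))

module _ {n : ℕ} {G : Graph n} where

  -- A nonempty face cut out by `c` and `δ` consists of all maximisers of `c`: a point of it gives δ
  -- ≤ `support G c`, and the center, which attains the support function, gives the reverse.
  isFace⇒face : ∀ F → IsFace (PG G) F → ∃ F → ∃ λ (O : PAO G) → F ≐ face G (ori O)
  isFace⇒face F (c , δ , valid , F⇔) (y , y∈F) = levelPAO G c ,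
    (λ x x∈F → let (x∈P , cx≡δ) = Equivalence.to (F⇔ x) x∈F in
      support⇒face G (level-compatible G c) x∈P (trans cx≡δ δ≡support)) ,
    (λ x x∈face → Equivalence.from (F⇔ x)
      (proj₁ x∈face , trans (face⇒support G (level-compatible G c) x∈face) (≡-sym δ≡support)))
    where
    δ≡support : δ ≡ support G c
    δ≡support = ℚ.≤-antisym
      (let (y∈P , cy≡δ) = Equivalence.to (F⇔ y) y∈F in subst (_≤ support G c) cy≡δ (dot≤support G y∈P c))
      (subst (_≤ δ) (dot-center≡support G (level-compatible G c)) (valid _ (center∈PG G (levelOri G c))))

-- Dimension

sumℕ-zero : ∀ n → sumℕ n (λ _ → 0) ≡ 0
sumℕ-zero n = trans (sumℕ≡sum n _) (Sumℕ.sum-replicate-zero n)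

module _ {n : ℕ} (β : Fin n → Fin n) where

  fiber? : ∀ a u → Dec (β u ≡ a)
  fiber? a u = β u Fin.≟ a

  -- A label `β v` need not lie in the block that it names; this chooses a vertex that does.
  rep : Fin n → Fin n
  rep v = pick v ⟪ fiber? (β v) ⟫

  β-rep : ∀ v → β (rep v) ≡ β v
  β-rep v = ∈⟪⟫⁻ (fiber? (β v)) (pick-∈ v (v , ∈⟪⟫⁺ (fiber? (β v)) refl))

  rep-cong : ∀ {u v} → β u ≡ β v → rep u ≡ rep v
  rep-cong {u} {v} eq = trans (cong (λ a → pick u ⟪ fiber? a ⟫) eq)
    (pick-irrelevant u v (v , ∈⟪⟫⁺ (fiber? (β v)) refl))

  rep-rep : ∀ v → rep (rep v) ≡ rep v
  rep-rep v = rep-cong (β-rep v)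

  isRep : Fin n → Bool
  isRep v = does (rep v Fin.≟ v)

  -- Double counting of the pairs (label a, representative of the block labelled a).
  count-isRep : count n isRep ≡ numBlocks β
  count-isRep = begin
    count n isRep                     ≡⟨ sumℕ-cong n (λ v → ≡-sym (one-label v)) ⟩
    sumℕ n (λ v → sumℕ n (pair v))    ≡⟨ sumℕ-swap n n pair ⟩
    sumℕ n (λ a → sumℕ n (λ v → pair v a)) ≡⟨ sumℕ-cong n (λ a → one-rep a (any? (fiber? a))) ⟩
    numBlocks β                       ∎
    where
    open ≡-Reasoning
    pair : Fin n → Fin n → ℕ
    pair v a = if does (fiber? a v) ∧ isRep v then 1 else 0
    one-label : ∀ v → sumℕ n (pair v) ≡ (if isRep v then 1 else 0)
    one-label v = trans
      (sumℕ-single n (pair v) (β v) λ a a≢ → cong (λ b → if b ∧ isRep v then 1 else 0) (dec-false (fiber? a v) (a≢ ∘ ≡-sym)))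
      (cong (λ b → if b ∧ isRep v then 1 else 0) (dec-true (fiber? (β v) v) refl))
    one-rep : ∀ a (d : Dec (∃ λ u → β u ≡ a)) → sumℕ n (λ v → pair v a) ≡ (if does d then 1 else 0)
    one-rep a (no ¬ex) = trans (sumℕ-cong n λ v → cong (λ b → if b ∧ isRep v then 1 else 0)
      (dec-false (fiber? a v) λ eq → ¬ex (v , eq))) (sumℕ-zero n)
    one-rep a (yes (u , refl)) = trans
      (sumℕ-single n (λ v → pair v (β u)) (rep u) λ v v≢ → other v v≢ (fiber? (β u) v))
      (cong (λ b → if b then 1 else 0) (cong₂ _∧_ (dec-true (fiber? (β u) (rep u)) (β-rep u))
        (dec-true (rep (rep u) Fin.≟ rep u) (rep-rep u))))
      where
      other : ∀ v → v ≢ rep u → (d : Dec (β v ≡ β u)) → (if does d ∧ isRep v then 1 else 0) ≡ 0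
      other v v≢ (no _)   = refl
      other v v≢ (yes eq) = cong (λ b → if b then 1 else 0)
        (dec-false (rep v Fin.≟ v) λ v-rep → v≢ (trans (≡-sym v-rep) (rep-cong eq)))

  isNonRep : Fin n → Bool
  isNonRep = not ∘ isRep

  -- Turns the dimension into a count of vertices, by which both dimension bounds are indexed.
  count-isNonRep : count n isNonRep ≡ n ∸ numBlocks β
  count-isNonRep = trans (≡-sym (ℕ.m+n∸m≡n (count n isRep) (count n isNonRep)))
    (cong₂ _∸_ (count+count-not n isRep) count-isRep)

  isNonRep⁻ : ∀ {v} → isNonRep v ≡ true → rep v ≢ v
  isNonRep⁻ {v} eq rep≡v with () ← trans (≡-sym (cong not (dec-true (rep v Fin.≟ v) rep≡v))) eq

  isNonRep⁺ : ∀ {v} → rep v ≢ v → isNonRep v ≡ true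
  isNonRep⁺ {v} rep≢v = cong not (dec-false (rep v Fin.≟ v) rep≢v)

unit : ∀ {n} → Fin n → Point n
unit v t = 𝟙 (does (v Fin.≟ t))

unit-self : ∀ {n} (v : Fin n) → unit v v ≡ 1ℚ
unit-self v = cong 𝟙 (dec-true (v Fin.≟ v) refl)

unit-≢ : ∀ {n} {v t : Fin n} → v ≢ t → unit v t ≡ 0ℚ
unit-≢ {v = v} {t} v≢t = cong 𝟙 (dec-false (v Fin.≟ t) v≢t)

dot-unit : ∀ {n} (a : Point n) v → dot a (unit v) ≡ a v
dot-unit {n} a v = trans
  (sumℚ-single n (λ t → a t * unit v t) v λ t t≢v →
    trans (cong (a t *_) (unit-≢ (t≢v ∘ ≡-sym))) (ℚ.*-zeroʳ (a t)))
  (trans (cong (a v *_) (unit-self v)) (ℚ.*-identityʳ (a v)))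

dot-combination : ∀ {n} k (a : Point n) μ p → dot a (combination k μ p) ≡ sumℚ k λ i → μ i * dot a (p i)
dot-combination {n} k a μ p = begin
  sumℚ n (λ t → a t * sumℚ k (λ i → μ i * p i t))
    ≡⟨ sumℚ-cong n (λ t → ≡-sym (sumℚ-*ˡ k (a t) (λ i → μ i * p i t))) ⟩
  sumℚ n (λ t → sumℚ k (λ i → a t * (μ i * p i t)))
    ≡⟨ sumℚ-swap n k (λ t i → a t * (μ i * p i t)) ⟩
  sumℚ k (λ i → sumℚ n (λ t → a t * (μ i * p i t)))
    ≡⟨ sumℚ-cong k (λ i → sumℚ-cong n λ t →
         solve 3 (λ a m p → a :* (m :* p) := m :* (a :* p)) refl (a t) (μ i) (p i t)) ⟩
  sumℚ k (λ i → sumℚ n (λ t → μ i * (a t * p i t)))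
    ≡⟨ sumℚ-cong k (λ i → sumℚ-*ˡ n (μ i) (λ t → a t * p i t)) ⟩
  sumℚ k (λ i → μ i * dot a (p i)) ∎
  where open ≡-Reasoning

module _ {n : ℕ} {G : Graph n} (O : PAO G) where

  private
    r : Fin n → Fin n
    r = rep (β O)
    N : Fin n → Bool
    N = isNonRep (β O)
    F : Point n → Set
    F = face G (ori O)

  shifted : Fin n → Point n
  shifted v t = center G (ori O) t + ½ * (unit v t + - 1ℚ * unit (r v) t)

  dot-shifted : ∀ a v → dot a (shifted v) ≡ dot a (center G (ori O)) + ½ * (a v + - 1ℚ * a (r v))
  dot-shifted a v = trans
    (dot-linearʳ a (center G (ori O)) (λ t → unit v t + - 1ℚ * unit (r v) t) ½)
    (cong (λ z → dot a (center G (ori O)) + ½ * z) (trans (dot-linearʳ a (unit v) (unit (r v)) (- 1ℚ))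
      (cong₂ (λ p q → p + - 1ℚ * q) (dot-unit a v) (dot-unit a (r v)))))

  indicator-rep : ∀ {S} → Closed G (ori O) S → ∀ v → indicator S (r v) ≡ indicator S v
  indicator-rep {S} closed v = cong 𝟙 (by (v ∈? S))
    where
    by : Dec (v ∈ S) → lookup S (r v) ≡ lookup S v
    by (yes v∈S) = trans ([]=⇒lookup (closed-block O closed (β-rep (β O) v) v∈S)) (≡-sym ([]=⇒lookup v∈S))
    by (no v∉S)  = trans (∉⇒lookup (v∉S ∘ closed-block O closed (≡-sym (β-rep (β O) v)))) (≡-sym (∉⇒lookup v∉S))

  -- The shift moves weight within one block, and a closed set contains either both vertices
  -- involved or neither.
  shifted-tight : ∀ v {S} → Closed G (ori O) S → Tight G (shifted v) S
  shifted-tight v {S} closed = begin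
    dot (indicator S) (shifted v)
      ≡⟨ dot-shifted (indicator S) v ⟩
    dot (indicator S) (center G (ori O)) + ½ * (indicator S v + - 1ℚ * indicator S (r v))
      ≡⟨ cong₂ (λ a b → a + ½ * (indicator S v + - 1ℚ * b)) (center-tight G (ori O) closed) (indicator-rep closed v) ⟩
    rank G S + ½ * (indicator S v + - 1ℚ * indicator S v)
      ≡⟨ solve 2 (λ k s → k :+ con ½ :* (s :+ :- con 1ℚ :* s) := k) refl (rank G S) (indicator S v) ⟩
    rank G S ∎
    where open ≡-Reasoning

  -- The slack ½ of the center on sets that are not closed absorbs the shift.
  shifted-bound : ∀ v S → rank G S ≤ dot (indicator S) (shifted v)
  shifted-bound v S with closed? (below? G (ori O)) S
  ... | inj₁ closed = ℚ.≤-reflexive (≡-sym (shifted-tight v closed))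
  ... | inj₂ (u , w , below , w∈S , u∉S) = begin
    rank G S                           ≡⟨ solve 1 (λ k → k := (k :+ con ½) :+ :- con ½) refl (rank G S) ⟩
    (rank G S + ½) + - ½               ≤⟨ ℚ.+-mono-≤ (center-slack G (ori O) S below w∈S u∉S) (shift≥ (lookup S v) (lookup S (r v))) ⟩
    dot (indicator S) (center G (ori O)) + ½ * (indicator S v + - 1ℚ * indicator S (r v))
                                       ≡⟨ dot-shifted (indicator S) v ⟨
    dot (indicator S) (shifted v)      ∎
    where
    open ℚ.≤-Reasoning
    shift : Bool → Bool → ℚ
    shift s t = ½ * (𝟙 s + - 1ℚ * 𝟙 t)
    shift≥ : ∀ s t → - ½ ≤ shift s t
    shift≥ true  true  = toWitness {a? = (- ½) ℚ.≤? shift true true} _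
    shift≥ true  false = toWitness {a? = (- ½) ℚ.≤? shift true false} _
    shift≥ false true  = toWitness {a? = (- ½) ℚ.≤? shift false true} _
    shift≥ false false = toWitness {a? = (- ½) ℚ.≤? shift false false} _

  shifted∈face : ∀ v → F (shifted v)
  shifted∈face v = PG⁺ G (shifted-tight v λ _ _ _ _ → ∈⊤) (shifted-bound v) , λ S → shifted-tight v

  -- Among the shifts of the enumerated vertices, only the one at `e i` changes coordinate `e i`:
  -- the subtracted unit vectors sit at representatives, which are never enumerated.
  independent : Σ (Fin (suc (count n N)) → Point n) λ p → (∀ i → F (p i)) × AffIndep p
  independent with enumerate n N
  ... | e , N-e , e-injective = p , p∈F , indep
    where
    p : Fin (suc (count n N)) → Point n
    p zero    = center G (ori O)
    p (suc i) = shifted (e i)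
    p∈F : ∀ i → F (p i)
    p∈F zero    = center∈face G (ori O)
    p∈F (suc i) = shifted∈face (e i)
    r≢e : ∀ i j → r (e i) ≢ e j
    r≢e i j eq = isNonRep⁻ (β O) (N-e j) (trans (cong r (≡-sym eq)) (trans (rep-rep (β O) (e i)) eq))
    off : ∀ μ x a b → a ≡ 0ℚ → b ≡ 0ℚ → μ * ((x + ½ * (a + - 1ℚ * b)) - x) ≡ 0ℚ
    off μ x _ _ refl refl = solve 2 (λ μ x →
      μ :* ((x :+ con ½ :* (con 0ℚ :+ :- con 1ℚ :* con 0ℚ)) :- x) := con 0ℚ) refl μ x
    on : ∀ μ x a b → a ≡ 1ℚ → b ≡ 0ℚ → μ * ((x + ½ * (a + - 1ℚ * b)) - x) ≡ μ * ½
    on μ x _ _ refl refl = solve 2 (λ μ x →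
      μ :* ((x :+ con ½ :* (con 1ℚ :+ :- con 1ℚ :* con 0ℚ)) :- x) := μ :* con ½) refl μ x
    indep : AffIndep p
    indep μ vanish i = begin
      -- Coordinate `e i` of the combination is `μ i * ½`; doubling it replaces a division.
      μ i                ≡⟨ solve 1 (λ μ → μ := μ :* con ½ :+ μ :* con ½) refl (μ i) ⟩
      μ i * ½ + μ i * ½  ≡⟨ cong₂ _+_ half half ⟩
      0ℚ + 0ℚ            ≡⟨ ℚ.+-identityʳ 0ℚ ⟩
      0ℚ                 ∎
      where
      open ≡-Reasoning
      x = center G (ori O) (e i)
      half : μ i * ½ ≡ 0ℚ
      half = trans (≡-sym (trans
        (sumℚ-single _ (λ j → μ j * (p (suc j) (e i) - p zero (e i))) i λ j j≢i →
          off (μ j) x (unit (e j) (e i)) (unit (r (e j)) (e i)) (unit-≢ (j≢i ∘ e-injective j i)) (unit-≢ (r≢e j i)))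
        (on (μ i) x (unit (e i) (e i)) (unit (r (e i)) (e i)) (unit-self (e i)) (unit-≢ (r≢e i i))))) (vanish (e i))

  strictDown? : ∀ v u → Dec (u ∈ down O v × β O u ≢ β O v)
  strictDown? v u = (u ∈? down O v) ×-dec ¬? (β O u Fin.≟ β O v)

  -- If `u` below `w` lay in the block of `v`, then `w` would be both above and below `v`, hence in
  -- that block too.
  strictDown-closed : ∀ v → Closed G (ori O) ⟪ strictDown? v ⟫
  strictDown-closed v u w below w∈ = ∈⟪⟫⁺ (strictDown? v) (u∈ , λ eq → w≢v
    (below*-antisym O (down⇒below* O v w∈down) (block⇒below* O (≡-sym eq) ◅◅ (below ◅ ε))))
    where
    w∈down = proj₁ (∈⟪⟫⁻ (strictDown? v) w∈)
    w≢v = proj₂ (∈⟪⟫⁻ (strictDown? v) w∈)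
    u∈ = down-closed O v u w below w∈down

  -- The block of v is the difference of the closed sets down v and strictDown v,
  -- so its sum vanishes, and v is the only coordinate of it that may be nonzero.
  vanish-at-rep : ∀ z → (∀ S → Closed G (ori O) S → dot (indicator S) z ≡ 0ℚ) →
    (∀ t → N t ≡ true → z t ≡ 0ℚ) → ∀ v → r v ≡ v → z v ≡ 0ℚ
  vanish-at-rep z ortho vanish v rv≡v = begin
    z v
      ≡⟨ solve 1 (λ z → z := (con 1ℚ :+ :- con 1ℚ :* con 0ℚ) :* z) refl (z v) ⟩
    (1ℚ + - 1ℚ * 0ℚ) * z v
      ≡⟨ cong₂ (λ a b → (a + - 1ℚ * b) * z v) (cong 𝟙 ([]=⇒lookup (self∈down O v)))
           (cong 𝟙 (∉⇒lookup λ v∈ → proj₂ (∈⟪⟫⁻ (strictDown? v) v∈) refl)) ⟨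
    a v * z v
      ≡⟨ sumℚ-single n (λ t → a t * z t) v (λ t t≢v → other t t≢v (β O t Fin.≟ β O v) (t ∈? D)) ⟨
    dot a z
      ≡⟨ dot-linearˡ (indicator D) (indicator D′) (- 1ℚ) z ⟩
    dot (indicator D) z + - 1ℚ * dot (indicator D′) z
      ≡⟨ cong₂ (λ p q → p + - 1ℚ * q) (ortho D (down-closed O v)) (ortho D′ (strictDown-closed v)) ⟩
    0ℚ ∎
    where
    open ≡-Reasoning
    D D′ : Subset n
    D = down O v
    D′ = ⟪ strictDown? v ⟫
    a : Point n
    a t = indicator D t + - 1ℚ * indicator D′ t
    cancel : ∀ s s′ z → s ≡ s′ → (𝟙 s + - 1ℚ * 𝟙 s′) * z ≡ 0ℚ
    cancel s _ z refl = solve 2 (λ s z → (s :+ :- con 1ℚ :* s) :* z := con 0ℚ) refl (𝟙 s) z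
    other : ∀ t → t ≢ v → Dec (β O t ≡ β O v) → Dec (t ∈ D) → a t * z t ≡ 0ℚ
    other t t≢v (yes eq) _ = trans (cong (a t *_) (vanish t (isNonRep⁺ (β O) λ rt≡t →
      t≢v (trans (≡-sym rt≡t) (trans (rep-cong (β O) eq) rv≡v))))) (ℚ.*-zeroʳ (a t))
    other t t≢v (no neq) (yes t∈D) = cancel (lookup D t) (lookup D′ t) (z t)
      (trans ([]=⇒lookup t∈D) (≡-sym ([]=⇒lookup (∈⟪⟫⁺ (strictDown? v) (t∈D , neq)))))
    other t t≢v (no neq) (no t∉D) = cancel (lookup D t) (lookup D′ t) (z t)
      (trans (∉⇒lookup t∉D) (≡-sym (∉⇒lookup (t∉D ∘ proj₁ ∘ ∈⟪⟫⁻ (strictDown? v)))))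

  -- There is one difference vector more than there are non-representatives, so some nontrivial
  -- combination vanishes at all of these. All closed sets are tight on the face, so the combination
  -- has sum 0 over each of them and vanishes at the representatives as well.
  dependent-points : ∀ (p : Fin (suc (suc (count n N))) → Point n) → (∀ i → F (p i)) → ¬ AffIndep p
  dependent-points p p∈F indep with dependent n (suc (count n N)) q N ℕ.≤-refl
    where
    q : Fin (suc (count n N)) → Point n
    q i t = p (suc i) t - p zero t
  ... | μ , vanish , i , μi≢0 = μi≢0 (indep μ (λ t → z≡0 t (r t Fin.≟ t)) i)
    where
    k = suc (count n N)
    q : Fin k → Point n
    q i t = p (suc i) t - p zero t
    dot-q : ∀ S → Closed G (ori O) S → ∀ i → dot (indicator S) (q i) ≡ 0ℚ
    dot-q S closed i = begin
      dot (indicator S) (q i)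
        ≡⟨ sumℚ-cong n (λ t → cong (indicator S t *_)
             (solve 2 (λ a b → a :- b := a :+ :- con 1ℚ :* b) refl (p (suc i) t) (p zero t))) ⟩
      dot (indicator S) (λ t → p (suc i) t + - 1ℚ * p zero t)
        ≡⟨ dot-linearʳ (indicator S) (p (suc i)) (p zero) (- 1ℚ) ⟩
      dot (indicator S) (p (suc i)) + - 1ℚ * dot (indicator S) (p zero)
        ≡⟨ cong₂ (λ a b → a + - 1ℚ * b) (proj₂ (p∈F (suc i)) S closed) (proj₂ (p∈F zero) S closed) ⟩
      rank G S + - 1ℚ * rank G S
        ≡⟨ solve 1 (λ k → k :+ :- con 1ℚ :* k := con 0ℚ) refl (rank G S) ⟩
      0ℚ ∎
      where open ≡-Reasoning
    ortho : ∀ S → Closed G (ori O) S → dot (indicator S) (combination k μ q) ≡ 0ℚ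
    ortho S closed = trans (dot-combination k (indicator S) μ q)
      (trans (sumℚ-cong k λ i → trans (cong (μ i *_) (dot-q S closed i)) (ℚ.*-zeroʳ (μ i))) (sumℚ-zero k))
    z≡0 : ∀ t → Dec (r t ≡ t) → combination k μ q t ≡ 0ℚ
    z≡0 t (yes rt≡t) = vanish-at-rep (combination k μ q) ortho vanish t rt≡t
    z≡0 t (no rt≢t)  = vanish t (isNonRep⁺ (β O) rt≢t)

  face-dimension : AffDim (face G (ori O)) (dimG O)
  face-dimension = subst (AffDim F) (count-isNonRep (β O)) (independent , dependent-points)

theorem2p15 : ∀ (n : ℕ) (G : Graph n) →
    Σ (PAO G → Point n → Set) λ φ →
    (∀ O → IsFace (PG G) (φ O) × Nonempty (φ O)) ×
    (∀ O O' → ori O ≈ₒ⟨ G ⟩ ori O' → φ O ≐ φ O') ×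
    (∀ O O' → φ O ≐ φ O' → ori O ≈ₒ⟨ G ⟩ ori O') ×
    (∀ F → IsFace (PG G) F → Nonempty F → ∃ λ O → F ≐ φ O) ×
    (∀ O O' → (φ O ⊆ₚ φ O') ⇔ (O ⪯z O')) ×
    (∀ O → AffDim (φ O) (dimG O))
theorem2p15 n G = (λ O → face G (ori O)) ,
  (λ O → compatible⇒isFace G (height-compatible O) , center G (ori O) , center∈face G (ori O)) ,
  (λ O O' O≈O' → face-respects {G = G} {ori O} {ori O'} O≈O' ,
    face-respects {G = G} {ori O'} {ori O} λ i j i<j ij → ≡-sym (O≈O' i j i<j ij)) ,
  face-injective ,
  isFace⇒face ,
  face-⊆⇔⪯z ,
  face-dimension
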